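{- Let $a=(a_i)_{i\in\mathbb Z}$ be any sequence of complex numbers and $\widehat a$ its dual sequence. For every Young diagram $\mu$, $\omega(s_{\mu;a})=s_{\mu';\widehat a}$, where $\mu'$ is the transposed diagram.
   Context: $\Lambda$ is the algebra of symmetric functions over $\mathbb C$, with complete homogeneous $h_k$, elementary $e_k$, power sums $\mathbf p_k$, Schur functions $s_\mu$. $\omega:\Lambda\to\Lambda$ is the involutive automorphism with $\omega(h_k)=e_k$ (so $\omega(e_k)=h_k$, $\omega(\mathbf p_k)=(-1)^{k-1}\mathbf p_k$, $\omega(s_\mu)=s_{\mu'}$). For a sequence $a=(a_i)_{i\in\mathbb Z}$ define $h_{k;a}=\sum_{i=1}^k(-1)^{k-i}e_{k-i}(a_1,\dots,a_{k-1})h_i$ for $k\ge1$, $h_{0;a}=1$, $h_{k;a}=0$ for $k<0$; let $(\tau^ra)_i=a_{i+r}$; and set $s_{\mu;a}=\det[h_{\mu_i-i+j;\,\tau^{1-j}a}]_{i,j=1}^N$ for any $N\ge\ell(\mu)$. The dual sequence $\widehat a$ is defined by $\widehat a_i=-a_{1-i}$, $i\in\mathbb Z$. -}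

module Defs where

open import Algebra.Bundles using (CommutativeRing; RawRing)
import Algebra.Definitions.RawMonoid as RawSum
import Algebra.Definitions.RawSemiring as RawSemi
open import Algebra.Morphism.Structures using (module RingMorphisms)
import Algebra.Properties.CommutativeMonoid.Sum as CMSum
import Algebra.Properties.Ring as RingProperties
open import Data.Bool.Base using (if_then_else_)
open import Data.Fin.Base using (Fin; zero; suc; toℕ)
open import Data.Fin.Properties using (toℕ≤pred[n])
open import Data.Integer.Base as ℤ using (ℤ; +_; -[1+_])
open import Data.List.Base using (List; []; _∷_; _∷ʳ_; length; filter; applyUpTo)
open import Data.List.Properties using (filter-accept; filter-reject)
open import Data.List.Relation.Binary.Permutation.Propositional
  as Perm using (_↭_; ↭-sym)
open import Data.List.Relation.Binary.Permutation.Propositional.Properties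
  using (All-resp-↭)
open import Data.List.Relation.Unary.All using (All; []; _∷_; all?)
import Data.List.Relation.Unary.All.Properties as All
open import Data.List.Relation.Unary.Linked using (Linked)
import Data.List.Relation.Unary.Linked.Properties as Linked
open import Data.Nat.Base as ℕ using (ℕ; zero; suc; z≤n; s≤s; z<s)
open import Data.Nat.ListAction using (sum)
open import Data.Nat.ListAction.Properties using (sum-++; sum-↭)
import Data.Nat.Properties as ℕ
open import Data.Product.Base using (∃-syntax; _×_; _,_; proj₁; proj₂)
open import Data.Sum.Base using (_⊎_; inj₁; inj₂)
open import Data.Vec.Functional using (removeAt)
open import Function.Base using (_∘_)
open import Level using (_⊔_)
open import Relation.Binary.PropositionalEquality as ≡ using (_≡_)
open import Relation.Nullary.Decidable.Core using (Dec; yes; no; does; _×-dec_)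
open import Relation.Nullary.Negation.Core using (contradiction)

------------------------------------------------------------------------
-- Young diagrams

record YoungDiagram : Set where
  field
    rows       : List ℕ
    decreasing : Linked ℕ._≥_ rows
    positive   : All (0 ℕ.<_) rows

open YoungDiagram public

-- Rows and columns are numbered from 0 here; rows below the diagram are empty.
row : List ℕ → ℕ → ℕ
row []       _       = 0
row (m ∷ _)  zero    = m
row (_ ∷ ms) (suc i) = row ms i

ℓ : YoungDiagram → ℕ
ℓ μ = length (rows μ)

columnLength : List ℕ → ℕ → ℕ
columnLength ms j = length (filter (j ℕ.<?_) ms)

columnLength-anti : ∀ ms j → columnLength ms (suc j) ℕ.≤ columnLength ms j
columnLength-anti []       j = z≤n
columnLength-anti (m ∷ ms) j with suc j ℕ.<? m | j ℕ.<? m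
... | yes p | yes q
  rewrite filter-accept (suc j ℕ.<?_) {xs = ms} p | filter-accept (j ℕ.<?_) {xs = ms} q
  = s≤s (columnLength-anti ms j)
... | yes p | no ¬q = contradiction (ℕ.<-trans (ℕ.n<1+n j) p) ¬q
... | no ¬p | yes q
  rewrite filter-reject (suc j ℕ.<?_) {xs = ms} ¬p | filter-accept (j ℕ.<?_) {xs = ms} q
  = ℕ.m≤n⇒m≤1+n (columnLength-anti ms j)
... | no ¬p | no ¬q
  rewrite filter-reject (suc j ℕ.<?_) {xs = ms} ¬p | filter-reject (j ℕ.<?_) {xs = ms} ¬q
  = columnLength-anti ms j

columnLength-pos : ∀ ms {j} → j ℕ.< row ms 0 → 0 ℕ.< columnLength ms j
columnLength-pos (m ∷ ms) {j} j<m rewrite filter-accept (j ℕ.<?_) {xs = ms} j<m = z<s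

infixl 9 _′

_′ : YoungDiagram → YoungDiagram
rows       (μ ′) = applyUpTo (columnLength (rows μ)) (row (rows μ) 0)
decreasing (μ ′) = Linked.applyUpTo⁺₁ _ _ λ {j} _ → columnLength-anti (rows μ) j
positive   (μ ′) = All.applyUpTo⁺₁ _ _ (columnLength-pos (rows μ))

------------------------------------------------------------------------
-- Determinants

module Determinant {c ℓ} (R : RawRing c ℓ) where
  open RawRing R
  open RawSum +-rawMonoid using () renaming (sum to ∑)
  open RawSemi rawSemiring using (_^_)

  -- Expansion along the first row.
  det : ∀ {n} → (Fin n → Fin n → Carrier) → Carrier
  det {zero}  A = 1#
  det {suc n} A = ∑ λ j →
    ((- 1#) ^ toℕ j * A zero j) * det (λ i → removeAt (A (suc i)) j)

------------------------------------------------------------------------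
-- Symmetric functions

module SymmetricFunctions {c r} (K : CommutativeRing c r) where
  open CommutativeRing K hiding (zero)
  open RawSum +-rawMonoid using () renaming (sum to ∑)
  open RawSemi (RawRing.rawSemiring rawRing) using (_^_)
  module S = CMSum +-commutativeMonoid
  module R = RingProperties ring

  -- A formal power series in x₁, x₂, …: the list α = [α₁, …, αₙ] stands
  -- for the monomial x₁^α₁ ⋯ xₙ^αₙ and is sent to its coefficient.
  Series : Set c
  Series = List ℕ → Carrier

  -- The coefficient of x₁ⁱ, as a series in the remaining variables.
  slice : Series → ℕ → Series
  slice f i β = f (i ∷ β)

  -- The Cauchy product (f · g)(α) = ∑ f(β) g(γ) over β + γ = α,
  -- organised one variable at a time.
  cauchy : Series → Series → Series
  cauchy f g []      = f [] * g []
  cauchy f g (n ∷ α) = ∑ {suc n} λ i →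
    cauchy (slice f (toℕ i)) (slice g (n ℕ.∸ toℕ i)) α

  TrailingZero Symmetric BoundedDegree : Series → Set r
  TrailingZero  f = ∀ α → f (α ∷ʳ 0) ≈ f α
  Symmetric     f = ∀ {α β} → α ↭ β → f α ≈ f β
  BoundedDegree f = ∃[ d ] ∀ α → d ℕ.< sum α → f α ≈ 0#

  -- The field trailingZero says that coeff depends only on the monomial,
  -- not on the list representing it.
  record Λ : Set (c ⊔ r) where
    field
      coeff        : Series
      trailingZero : TrailingZero coeff
      symmetric    : Symmetric coeff
      bounded      : BoundedDegree coeff

  open Λ public

  infix 4 _≋_

  _≋_ : Λ → Λ → Set r
  f ≋ g = ∀ α → coeff f α ≈ coeff g α

  cauchy-cong : ∀ {f f′ g g′ : Series} →
    (∀ α → f α ≈ f′ α) → (∀ α → g α ≈ g′ α) →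
    ∀ α → cauchy f g α ≈ cauchy f′ g′ α
  cauchy-cong p q []      = *-cong (p []) (q [])
  cauchy-cong p q (n ∷ α) = S.sum-cong-≋ {suc n} λ i →
    cauchy-cong (λ β → p (toℕ i ∷ β)) (λ γ → q ((n ℕ.∸ toℕ i) ∷ γ)) α

  cauchy-trailingZero : ∀ {f g : Series} →
    TrailingZero f → TrailingZero g → TrailingZero (cauchy f g)
  cauchy-trailingZero p q []      = trans (+-identityʳ _) (*-cong (p []) (q []))
  cauchy-trailingZero p q (n ∷ α) = S.sum-cong-≋ {suc n} λ i →
    cauchy-trailingZero (λ β → p (toℕ i ∷ β)) (λ γ → q ((n ℕ.∸ toℕ i) ∷ γ)) α

  cauchy-symmetric : ∀ (f g : Series) →
    Symmetric f → Symmetric g → Symmetric (cauchy f g)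
  cauchy-symmetric f g p q Perm.refl = refl
  cauchy-symmetric f g p q (Perm.prep x π) = S.sum-cong-≋ {suc x} λ i →
    cauchy-symmetric (slice f (toℕ i)) (slice g (x ℕ.∸ toℕ i))
      (λ ρ → p (Perm.prep _ ρ)) (λ ρ → q (Perm.prep _ ρ)) π
  cauchy-symmetric f g p q (Perm.swap {xs = α} {ys = β} x y π) = trans
    (S.∑-comm {suc x} {suc y} λ i j → cauchy
      (slice (slice f (toℕ i)) (toℕ j))
      (slice (slice g (x ℕ.∸ toℕ i)) (y ℕ.∸ toℕ j)) α)
    (S.sum-cong-≋ {suc y} λ j → S.sum-cong-≋ {suc x} λ i → trans
      (cauchy-cong (λ _ → p (Perm.swap _ _ Perm.refl)) (λ _ → q (Perm.swap _ _ Perm.refl)) α)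
      (cauchy-symmetric
        (slice (slice f (toℕ j)) (toℕ i))
        (slice (slice g (y ℕ.∸ toℕ j)) (x ℕ.∸ toℕ i))
        (λ ρ → p (Perm.prep _ (Perm.prep _ ρ)))
        (λ ρ → q (Perm.prep _ (Perm.prep _ ρ))) π))
  cauchy-symmetric f g p q (Perm.trans π ρ) =
    trans (cauchy-symmetric f g p q π) (cauchy-symmetric f g p q ρ)

  cauchy-vanish : ∀ (f g : Series) α →
    (∀ β γ → sum β ℕ.+ sum γ ≡ sum α → f β * g γ ≈ 0#) → cauchy f g α ≈ 0#
  cauchy-vanish f g []      p = p [] [] ≡.refl
  cauchy-vanish f g (n ∷ α) p = trans
    (S.sum-cong-≋ {suc n} λ i → cauchy-vanish (slice f (toℕ i)) (slice g (n ℕ.∸ toℕ i)) α λ β γ eq →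
      p (toℕ i ∷ β) ((n ℕ.∸ toℕ i) ∷ γ) (shift i β γ eq))
    (S.sum-replicate-zero (suc n))
    where
    open ≡.≡-Reasoning
    shift : ∀ (i : Fin (suc n)) β γ → sum β ℕ.+ sum γ ≡ sum α →
      (toℕ i ℕ.+ sum β) ℕ.+ ((n ℕ.∸ toℕ i) ℕ.+ sum γ) ≡ n ℕ.+ sum α
    shift i β γ eq = begin
      (toℕ i ℕ.+ sum β) ℕ.+ ((n ℕ.∸ toℕ i) ℕ.+ sum γ)
        ≡⟨ ℕ.+-assoc (toℕ i) _ _ ⟩
      toℕ i ℕ.+ (sum β ℕ.+ ((n ℕ.∸ toℕ i) ℕ.+ sum γ))
        ≡⟨ ≡.cong (toℕ i ℕ.+_) (≡.sym (ℕ.+-assoc (sum β) _ _)) ⟩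
      toℕ i ℕ.+ ((sum β ℕ.+ (n ℕ.∸ toℕ i)) ℕ.+ sum γ)
        ≡⟨ ≡.cong (λ t → toℕ i ℕ.+ (t ℕ.+ sum γ)) (ℕ.+-comm (sum β) _) ⟩
      toℕ i ℕ.+ (((n ℕ.∸ toℕ i) ℕ.+ sum β) ℕ.+ sum γ)
        ≡⟨ ≡.cong (toℕ i ℕ.+_) (ℕ.+-assoc (n ℕ.∸ toℕ i) _ _) ⟩
      toℕ i ℕ.+ ((n ℕ.∸ toℕ i) ℕ.+ (sum β ℕ.+ sum γ))
        ≡⟨ ≡.sym (ℕ.+-assoc (toℕ i) _ _) ⟩
      (toℕ i ℕ.+ (n ℕ.∸ toℕ i)) ℕ.+ (sum β ℕ.+ sum γ)
        ≡⟨ ≡.cong₂ ℕ._+_ (ℕ.m+[n∸m]≡n (toℕ≤pred[n] i)) eq ⟩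
      n ℕ.+ sum α ∎

  exceeds : ∀ {d e} m n → d ℕ.+ e ℕ.< m ℕ.+ n → d ℕ.< m ⊎ e ℕ.< n
  exceeds {d} {e} m n lt with d ℕ.<? m
  ... | yes p = inj₁ p
  ... | no ¬p with e ℕ.<? n
  ...   | yes q = inj₂ q
  ...   | no ¬q = contradiction
    (ℕ.+-mono-≤ (ℕ.≮⇒≥ ¬p) (ℕ.≮⇒≥ ¬q)) (ℕ.<⇒≱ lt)

  cauchy-bounded : ∀ {f g : Series} →
    BoundedDegree f → BoundedDegree g → BoundedDegree (cauchy f g)
  cauchy-bounded {f} {g} (d , p) (e , q) = d ℕ.+ e , λ α lt →
    cauchy-vanish f g α λ β γ eq → vanish β γ (≡.subst (d ℕ.+ e ℕ.<_) (≡.sym eq) lt)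
    where
    vanish : ∀ β γ → d ℕ.+ e ℕ.< sum β ℕ.+ sum γ → f β * g γ ≈ 0#
    vanish β γ lt with exceeds (sum β) (sum γ) lt
    ... | inj₁ x = trans (*-congʳ (p β x)) (zeroˡ _)
    ... | inj₂ x = trans (*-congˡ (q γ x)) (zeroʳ _)

  sum-∷ʳ0 : ∀ α → sum (α ∷ʳ 0) ≡ sum α
  sum-∷ʳ0 α = ≡.trans (sum-++ α (0 ∷ [])) (ℕ.+-identityʳ (sum α))

  indicator : ∀ {p} {P : Set p} → Dec P → Carrier
  indicator P? = if does P? then 1# else 0#

  indicator-⇔ : ∀ {p q} {P : Set p} {Q : Set q} (P? : Dec P) (Q? : Dec Q) →
    (P → Q) → (Q → P) → indicator P? ≈ indicator Q?
  indicator-⇔ (yes _) (yes _) f g = refl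
  indicator-⇔ (yes p) (no ¬q) f g = contradiction (f p) ¬q
  indicator-⇔ (no ¬p) (yes q) f g = contradiction (g q) ¬p
  indicator-⇔ (no _)  (no _)  f g = refl

  indicator-no : ∀ {p} {P : Set p} (P? : Dec P) →
    (P → 1# ≈ 0#) → indicator P? ≈ 0#
  indicator-no (yes p) f = f p
  indicator-no (no _)  f = refl

  -- h k is the sum of all monomials of degree k.
  h : ℕ → Λ
  coeff        (h k) α = indicator (sum α ℕ.≟ k)
  trailingZero (h k) α rewrite sum-∷ʳ0 α = refl
  symmetric    (h k) π rewrite sum-↭ π = refl
  bounded      (h k) = k , λ α lt → indicator-no (sum α ℕ.≟ k)
    λ eq → contradiction (≡.sym eq) (ℕ.<⇒≢ lt)

  squarefree? : ∀ k α → Dec (sum α ≡ k × All (ℕ._≤ 1) α)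
  squarefree? k α = sum α ℕ.≟ k ×-dec all? (ℕ._≤? 1) α

  -- e k is the sum of all squarefree monomials of degree k.
  e : ℕ → Λ
  coeff        (e k) α = indicator (squarefree? k α)
  trailingZero (e k) α = indicator-⇔ (squarefree? k (α ∷ʳ 0)) (squarefree? k α)
    (λ (p , q) → ≡.trans (≡.sym (sum-∷ʳ0 α)) p , proj₁ (All.∷ʳ⁻ q))
    (λ (p , q) → ≡.trans (sum-∷ʳ0 α) p , All.∷ʳ⁺ q z≤n)
  symmetric    (e k) {α} {β} π = indicator-⇔ (squarefree? k α) (squarefree? k β)
    (λ (p , q) → ≡.trans (≡.sym (sum-↭ π)) p , All-resp-↭ π q)
    (λ (p , q) → ≡.trans (sum-↭ π) p , All-resp-↭ (↭-sym π) q)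
  bounded      (e k) = k , λ α lt → indicator-no (squarefree? k α)
    λ (eq , _) → contradiction (≡.sym eq) (ℕ.<⇒≢ lt)

  infixl 6 _⊕_
  infixl 7 _⊗_
  infixr 7 _·_

  _⊕_ _⊗_ : Λ → Λ → Λ
  coeff        (f ⊕ g) α = coeff f α + coeff g α
  trailingZero (f ⊕ g) α = +-cong (trailingZero f α) (trailingZero g α)
  symmetric    (f ⊕ g) π = +-cong (symmetric f π) (symmetric g π)
  bounded      (f ⊕ g)   = let (d , p) = bounded f ; (d′ , q) = bounded g in
    d ℕ.+ d′ , λ α lt → trans
      (+-cong (p α (ℕ.≤-<-trans (ℕ.m≤m+n d d′) lt)) (q α (ℕ.≤-<-trans (ℕ.m≤n+m d′ d) lt)))
      (+-identityˡ 0#)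

  coeff        (f ⊗ g) = cauchy (coeff f) (coeff g)
  trailingZero (f ⊗ g) = cauchy-trailingZero (trailingZero f) (trailingZero g)
  symmetric    (f ⊗ g) = cauchy-symmetric (coeff f) (coeff g) (symmetric f) (symmetric g)
  bounded      (f ⊗ g) = cauchy-bounded {coeff f} {coeff g} (bounded f) (bounded g)

  _·_ : Carrier → Λ → Λ
  coeff        (x · f) α = x * coeff f α
  trailingZero (x · f) α = *-congˡ (trailingZero f α)
  symmetric    (x · f) π = *-congˡ (symmetric f π)
  bounded      (x · f)   = let (d , p) = bounded f in
    d , λ α lt → trans (*-congˡ (p α lt)) (zeroʳ x)

  ⊖_ : Λ → Λ
  coeff        (⊖ f) α = - coeff f α
  trailingZero (⊖ f) α = -‿cong (trailingZero f α)
  symmetric    (⊖ f) π = -‿cong (symmetric f π)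
  bounded      (⊖ f)   = let (d , p) = bounded f in
    d , λ α lt → trans (-‿cong (p α lt)) R.-0#≈0#

  𝟘 𝟙 : Λ
  coeff        𝟘 α = 0#
  trailingZero 𝟘 α = refl
  symmetric    𝟘 π = refl
  bounded      𝟘   = 0 , λ α lt → refl

  -- The empty monomial is the only one of degree 0.
  𝟙 = h 0

  Λ-rawRing : RawRing (c ⊔ r) r
  Λ-rawRing = record
    { Carrier = Λ ; _≈_ = _≋_ ; _+_ = _⊕_ ; _*_ = _⊗_ ; -_ = ⊖_ ; 0# = 𝟘 ; 1# = 𝟙 }

  -- As Λ is the polynomial algebra on h 1, h 2, …, exactly one such ω exists
  -- up to _≋_.
  record IsOmega (ω : Λ → Λ) : Set (c ⊔ r) where
    field
      isRingIsomorphism : RingMorphisms.IsRingIsomorphism Λ-rawRing Λ-rawRing ω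
      ·-homo            : ∀ x f → ω (x · f) ≋ x · ω f
      involutive        : ∀ f → ω (ω f) ≋ f
      h↦e               : ∀ k → ω (h k) ≋ e k

------------------------------------------------------------------------
-- Multiparameter Schur functions

  Sequence : Set c
  Sequence = ℤ → Carrier

  τ : ℤ → Sequence → Sequence
  τ k a i = a (i ℤ.+ k)

  dual : Sequence → Sequence
  dual a i = - a (+ 1 ℤ.- i)

  -- The value of the k-th elementary symmetric polynomial at a list of
  -- scalars: the subsets of size k + 1 of x ∷ xs either contain x or not.
  elementary : ℕ → List Carrier → Carrier
  elementary zero    _        = 1#
  elementary (suc k) []       = 0#
  elementary (suc k) (x ∷ xs) = x * elementary k xs + elementary (suc k) xs

  open RawSum (RawRing.+-rawMonoid Λ-rawRing) using () renaming (sum to ∑Λ)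

  hₐ : ℤ → Sequence → Λ
  hₐ (+ zero)  a = 𝟙
  hₐ (+ suc m) a = ∑Λ {k} λ i′ → let i = suc (toℕ i′) in
    ((- 1#) ^ (k ℕ.∸ i) * elementary (k ℕ.∸ i) a₁…aₖ₋₁) · h i
    where
    k       = suc m
    a₁…aₖ₋₁ = applyUpTo (λ n → a (+ suc n)) m
  hₐ -[1+ _ ]  a = 𝟘

  open Determinant Λ-rawRing using (det)

  s : (N : ℕ) → YoungDiagram → Sequence → Λ
  s N μ a = det {N} λ i′ j′ →
    let i = + suc (toℕ i′) ; j = + suc (toℕ j′) in
    hₐ (+ row (rows μ) (toℕ i′) ℤ.- i ℤ.+ j) (τ (+ 1 ℤ.- j) a)

{-# OPTIONS --safe #-}

-- The matrix entries h_{p-q; τ^{q+1} a}, p ≥ q, are the coefficients of t^(p-q) in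
-- H(t) ∏ (1 - a_i t), the product being over q + 2 ≤ i ≤ p.  Matrices of this shape multiply
-- like the power series they are built from, so E(t) H(-t) = 1 turns ω of this matrix
-- and the signed transpose of the one for the dual sequence into inverse unitriangular
-- matrices.  The rows μ_i - i of the first and j - 1 - μ′_j of the second are complementary,
-- and the theorem is Jacobi's identity for complementary minors.
--
-- That identity is proved with alternating forms, written as functions of lists of
-- arguments: if f_p and g_u are dual bases, contracting with the g_u, u ∈ J, turns
-- f_J ∧ f_I into f_I; evaluating both sides at the lowest positions gives the two minors.
module Submission where

open import Defs
open import Algebra.Bundles using (CommutativeRing; CommutativeMonoid; RawRing)
import Algebra.Definitions.RawSemiring as RawSemi
open import Algebra.Morphism.Structures using (module RingMorphisms)
import Algebra.Properties.CommutativeSemigroup as CommutativeSemigroupProperties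
import Algebra.Properties.Ring as RingProperties
import Algebra.Properties.Semiring.Sum as SemiringSum
open import Algebra.Structures using (IsCommutativeRing)
open import Data.Fin.Base using (Fin; toℕ; punchIn) renaming (zero to fzero; suc to fsuc)
open import Data.Fin.Properties using (toℕ<n)
open import Data.Integer.Base as ℤ using (+_; -[1+_])
import Data.Integer.Properties as ℤ
open import Data.Integer.Solver using (module +-*-Solver)
open import Data.List.Base
  using (List; []; _∷_; _∷ʳ_; _++_; length; applyUpTo; downFrom; tabulate)
open import Data.List.Membership.Propositional.Properties using (∈-downFrom⁻)
open import Data.List.Properties
  using (length-applyUpTo; applyUpTo-∷ʳ; filter-accept; filter-reject)
open import Data.List.Relation.Unary.All as All using (All; []; _∷_)
import Data.List.Relation.Unary.All.Properties as All
open import Data.List.Relation.Unary.AllPairs using ([]; _∷_)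
import Data.List.Relation.Unary.AllPairs.Properties as AllPairs
open import Data.List.Relation.Unary.Linked as Linked using (Linked; [-]; _∷_)
open import Data.List.Relation.Unary.Unique.Propositional using (Unique)
import Data.List.Relation.Unary.Unique.Propositional.Properties as Unique
open import Data.Nat.Base as ℕ using (ℕ; zero; suc; _≤_; z≤n; s≤s; z<s; s<s)
open import Data.Nat.ListAction using (sum)
open import Data.Nat.ListAction.Properties using (sum-++)
import Data.Nat.Properties as ℕ
open import Data.Product.Base using (_×_; _,_; proj₁)
open import Data.Sum.Base using (inj₁; inj₂)
open import Data.Vec.Functional using (removeAt)
open import Function.Base using (_∘_; flip)
open import Relation.Binary.Definitions using (tri<; tri≈; tri>)
open import Relation.Binary.PropositionalEquality as ≡ using (_≡_; _≢_)
import Relation.Binary.Reasoning.Setoid as SetoidReasoning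
open import Relation.Nullary.Decidable.Core using (yes; no)
open import Relation.Nullary.Negation.Core using (contradiction)

-- All positions are raised by `N`, which makes them natural numbers below `N + M`. As the matrices
-- are lower triangular, cutting their product off at `N + M` loses nothing. The product in an entry
-- leaves out both end points, so it has p - q - 1 factors, one fewer than the degree that is read
-- off. Hence the series 1 gives the identity matrix, and below the diagonal the constant term of
-- the series never contributes, just as the sum defining `hₐ` starts at `h 1`. The recursion for
-- `F` goes from one row to the next: row p + 1 brings in the factor 1 - b p t, except in column q =
-- p, where the product is still empty; the summand `b p * ε p q` compensates for this. Two signs
-- arise. Sorting the boundary positions costs one transposition for each cell of the diagram, and
-- the signed transpose contributes the parity of the sum of all rows and columns of the minor. They
-- cancel because `colPos j + cl j` equals `N + j`.

-- Sums over antidiagonals.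

module Antidiagonal {c ℓ} (R : CommutativeRing c ℓ) where
  open CommutativeRing R hiding (zero)
  open SemiringSum semiring using () renaming (sum to ∑)
  open CommutativeSemigroupProperties
    (CommutativeMonoid.commutativeSemigroup +-commutativeMonoid) using (interchange)
  open SetoidReasoning setoid

  -- ▵ n f = ∑ f i j over i + j = n.
  ▵ : ℕ → (ℕ → ℕ → Carrier) → Carrier
  ▵ zero    f = f 0 0
  ▵ (suc n) f = f 0 (suc n) + ▵ n (λ i j → f (suc i) j)

  ▵-cong : ∀ n {f g} → (∀ i j → i ℕ.+ j ≡ n → f i j ≈ g i j) → ▵ n f ≈ ▵ n g
  ▵-cong zero    p = p 0 0 ≡.refl
  ▵-cong (suc n) p =
    +-cong (p 0 (suc n) ≡.refl) (▵-cong n λ i j eq → p (suc i) j (≡.cong suc eq))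

  ▵-cong′ : ∀ n {f g} → (∀ i j → f i j ≈ g i j) → ▵ n f ≈ ▵ n g
  ▵-cong′ n p = ▵-cong n λ i j _ → p i j

  ▵-zero : ∀ n {f} → (∀ i j → i ℕ.+ j ≡ n → f i j ≈ 0#) → ▵ n f ≈ 0#
  ▵-zero zero    p = p 0 0 ≡.refl
  ▵-zero (suc n) p = trans
    (+-cong (p 0 (suc n) ≡.refl) (▵-zero n λ i j eq → p (suc i) j (≡.cong suc eq)))
    (+-identityˡ 0#)

  ▵-+ : ∀ n f g → ▵ n (λ i j → f i j + g i j) ≈ ▵ n f + ▵ n g
  ▵-+ zero    f g = refl
  ▵-+ (suc n) f g = trans (+-congˡ (▵-+ n _ _)) (interchange _ _ _ _)

  ▵-*ˡ : ∀ n x f → x * ▵ n f ≈ ▵ n (λ i j → x * f i j)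
  ▵-*ˡ zero    x f = refl
  ▵-*ˡ (suc n) x f = trans (distribˡ _ _ _) (+-congˡ (▵-*ˡ n x _))

  ▵-last : ∀ n f → ▵ (suc n) f ≈ ▵ n (λ i j → f i (suc j)) + f (suc n) 0
  ▵-last zero    f = refl
  ▵-last (suc n) f =
    trans (+-congˡ (▵-last n λ i j → f (suc i) j)) (sym (+-assoc _ _ _))

  ▵-comm : ∀ n f → ▵ n f ≈ ▵ n (flip f)
  ▵-comm zero    f = refl
  ▵-comm (suc n) f = begin
    f 0 (suc n) + ▵ n (λ i j → f (suc i) j) ≈⟨ +-congˡ (▵-comm n _) ⟩
    f 0 (suc n) + ▵ n (λ i j → f (suc j) i) ≈⟨ +-comm _ _ ⟩
    ▵ n (λ i j → f (suc j) i) + f 0 (suc n) ≈⟨ ▵-last n (flip f) ⟨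
    ▵ (suc n) (flip f)                      ∎

  ▵-assoc : ∀ n (f : ℕ → ℕ → ℕ → Carrier) →
    ▵ n (λ m k → ▵ m (λ i j → f i j k)) ≈ ▵ n (λ i m → ▵ m (λ j k → f i j k))
  ▵-assoc zero    f = refl
  ▵-assoc (suc n) f = begin
    f 0 0 (suc n) + ▵ n (λ m k → f 0 (suc m) k + ▵ m (λ i j → f (suc i) j k))
      ≈⟨ +-congˡ (▵-+ n _ _) ⟩
    f 0 0 (suc n) + (▵ n (λ m k → f 0 (suc m) k) + ▵ n (λ m k → ▵ m (λ i j → f (suc i) j k)))
      ≈⟨ +-assoc _ _ _ ⟨
    ▵ (suc n) (f 0) + ▵ n (λ m k → ▵ m (λ i j → f (suc i) j k))
      ≈⟨ +-congˡ (▵-assoc n _) ⟩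
    ▵ (suc n) (f 0) + ▵ n (λ i m → ▵ m (λ j k → f (suc i) j k)) ∎

  -- Bridge to the definitions of `cauchy` and `hₐ`, which sum over `Fin` with truncated
  -- subtraction; in `▵` both indices are explicit and inductions need no bounds.
  ∑-▵ : ∀ n f → ∑ {suc n} (λ i → f (toℕ i) (n ℕ.∸ toℕ i)) ≈ ▵ n f
  ∑-▵ zero    f = +-identityʳ _
  ∑-▵ (suc n) f = +-congˡ (∑-▵ n λ i j → f (suc i) j)

-- Wedge products of covectors, and minors as their values.

module Forms {c ℓ} (R : CommutativeRing c ℓ) where
  open CommutativeRing R hiding (zero)
  open RawSemi (RawRing.rawSemiring rawRing) using (_^_)
  open SemiringSum semiring using (sum-cong-≋; sum-replicate-zero) renaming (sum to ∑)
  open RingProperties ring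
  open CommutativeSemigroupProperties
    (CommutativeMonoid.commutativeSemigroup +-commutativeMonoid) using (interchange; x∙yz≈y∙xz)
  open CommutativeSemigroupProperties
    (CommutativeMonoid.commutativeSemigroup *-commutativeMonoid) using ()
    renaming (x∙yz≈y∙xz to x*yz≈y*xz)
  open Determinant rawRing using (det)
  open SetoidReasoning setoid

  ∑-zero : ∀ {n} {f : Fin n → Carrier} → (∀ i → f i ≈ 0#) → ∑ f ≈ 0#
  ∑-zero {n} p = trans (sum-cong-≋ p) (sum-replicate-zero n)

  ∑-neg : ∀ {n} (f : Fin n → Carrier) → ∑ (λ i → - f i) ≈ - ∑ f
  ∑-neg {zero}  f = sym -0#≈0#
  ∑-neg {suc n} f = trans (+-congˡ (∑-neg {n} (f ∘ fsuc))) (-‿+-comm _ _)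

  Vector Form : Set c
  Vector = ℕ → Carrier
  Form   = List ℕ → Carrier

  vac : Form
  vac []      = 1#
  vac (_ ∷ _) = 0#

  -- wedge v φ (x₀ ∷ … ∷ xₖ) = ∑ (-1)ʲ v xⱼ φ (x₀ … x̂ⱼ … xₖ).
  wedge : Vector → Form → Form
  wedge v φ []       = 0#
  wedge v φ (x ∷ xs) = v x * φ xs - wedge v (φ ∘ (x ∷_)) xs

  -- `wedge` evaluates the form only at lists with one entry deleted, so agreement is needed only
  -- there; such lists are shorter by one and inherit `P`.
  wedge-congᵖ : ∀ {p} {P : ℕ → Set p} v {φ ψ} xs → All P xs →
    (∀ ys → All P ys → suc (length ys) ≡ length xs → φ ys ≈ ψ ys) →
    wedge v φ xs ≈ wedge v ψ xs
  wedge-congᵖ v []       []         eq = refl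
  wedge-congᵖ v (x ∷ xs) (px ∷ pxs) eq = +-cong
    (*-congˡ (eq xs pxs ≡.refl))
    (-‿cong (wedge-congᵖ v xs pxs λ ys pys len → eq (x ∷ ys) (px ∷ pys) (≡.cong suc len)))

  wedge-cong : ∀ {v w φ ψ} → (∀ x → v x ≈ w x) → (∀ xs → φ xs ≈ ψ xs) →
    ∀ xs → wedge v φ xs ≈ wedge w ψ xs
  wedge-cong p q []       = refl
  wedge-cong p q (x ∷ xs) =
    +-cong (*-cong (p x) (q xs)) (-‿cong (wedge-cong p (λ ys → q (x ∷ ys)) xs))

  wedge-congʳ : ∀ {v φ ψ} → (∀ xs → φ xs ≈ ψ xs) → ∀ xs → wedge v φ xs ≈ wedge v ψ xs
  wedge-congʳ = wedge-cong λ _ → refl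

  wedge-zeroʳ : ∀ v {φ} → (∀ xs → φ xs ≈ 0#) → ∀ xs → wedge v φ xs ≈ 0#
  wedge-zeroʳ v p []       = refl
  wedge-zeroʳ v p (x ∷ xs) = trans
    (+-cong (trans (*-congˡ (p xs)) (zeroʳ _))
            (trans (-‿cong (wedge-zeroʳ v (λ ys → p (x ∷ ys)) xs)) -0#≈0#))
    (+-identityˡ 0#)

  wedge-zeroˡ : ∀ {v} φ → (∀ x → v x ≈ 0#) → ∀ xs → wedge v φ xs ≈ 0#
  wedge-zeroˡ φ p []       = refl
  wedge-zeroˡ φ p (x ∷ xs) = trans
    (+-cong (trans (*-congʳ (p x)) (zeroˡ _))
            (trans (-‿cong (wedge-zeroˡ _ p xs)) -0#≈0#))
    (+-identityˡ 0#)

  sub-interchange : ∀ a b c d → (a + b) - (c + d) ≈ (a - c) + (b - d)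
  sub-interchange a b c d =
    trans (+-congˡ (sym (-‿+-comm c d))) (interchange a b (- c) (- d))

  wedge-+ʳ : ∀ v φ ψ xs → wedge v (λ ys → φ ys + ψ ys) xs ≈ wedge v φ xs + wedge v ψ xs
  wedge-+ʳ v φ ψ []       = sym (+-identityˡ 0#)
  wedge-+ʳ v φ ψ (x ∷ xs) = trans
    (+-cong (distribˡ _ _ _) (-‿cong (wedge-+ʳ v _ _ xs)))
    (sub-interchange _ _ _ _)

  wedge-+ˡ : ∀ v w φ xs → wedge (λ x → v x + w x) φ xs ≈ wedge v φ xs + wedge w φ xs
  wedge-+ˡ v w φ []       = sym (+-identityˡ 0#)
  wedge-+ˡ v w φ (x ∷ xs) = trans
    (+-cong (distribʳ _ _ _) (-‿cong (wedge-+ˡ v w _ xs)))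
    (sub-interchange _ _ _ _)

  *-distribˡ-sub : ∀ a b c → a * (b - c) ≈ a * b - a * c
  *-distribˡ-sub a b c = trans (distribˡ _ _ _) (+-congˡ (sym (-‿distribʳ-* _ _)))

  wedge-*ʳ : ∀ v a φ xs → wedge v (λ ys → a * φ ys) xs ≈ a * wedge v φ xs
  wedge-*ʳ v a φ []       = sym (zeroʳ a)
  wedge-*ʳ v a φ (x ∷ xs) = trans
    (+-cong (x*yz≈y*xz _ _ _) (-‿cong (wedge-*ʳ v a _ xs)))
    (sym (*-distribˡ-sub _ _ _))

  wedge-*ˡ : ∀ a v φ xs → wedge (λ x → a * v x) φ xs ≈ a * wedge v φ xs
  wedge-*ˡ a v φ []       = sym (zeroʳ a)
  wedge-*ˡ a v φ (x ∷ xs) = trans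
    (+-cong (*-assoc _ _ _) (-‿cong (wedge-*ˡ a v _ xs)))
    (sym (*-distribˡ-sub _ _ _))

  wedge-neg : ∀ v φ xs → wedge v (λ ys → - φ ys) xs ≈ - wedge v φ xs
  wedge-neg v φ []       = sym -0#≈0#
  wedge-neg v φ (x ∷ xs) = trans
    (+-cong (sym (-‿distribʳ-* _ _)) (-‿cong (wedge-neg v _ xs)))
    (-‿+-comm _ _)

  wedge-∑ʳ : ∀ {n} v (φ : Fin n → Form) xs →
    wedge v (λ ys → ∑ (λ i → φ i ys)) xs ≈ ∑ (λ i → wedge v (φ i) xs)
  wedge-∑ʳ {zero}  v φ xs = wedge-zeroʳ v (λ _ → refl) xs
  wedge-∑ʳ {suc n} v φ xs =
    trans (wedge-+ʳ v _ _ xs) (+-congˡ (wedge-∑ʳ v (φ ∘ fsuc) xs))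

  wedge-∑ˡ : ∀ {n} (v : Fin n → Vector) φ xs →
    wedge (λ x → ∑ (λ i → v i x)) φ xs ≈ ∑ (λ i → wedge (v i) φ xs)
  wedge-∑ˡ {zero}  v φ xs = wedge-zeroˡ φ (λ _ → refl) xs
  wedge-∑ˡ {suc n} v φ xs =
    trans (wedge-+ˡ _ _ φ xs) (+-congˡ (wedge-∑ˡ (v ∘ fsuc) φ xs))

  -- The function `φ` need not alternate: the sign only records in which order the two covectors
  -- take their arguments.
  wedge-anticomm : ∀ v w φ xs → wedge v (wedge w φ) xs ≈ - wedge w (wedge v φ) xs
  wedge-anticomm v w φ []       = sym -0#≈0#
  wedge-anticomm v w φ (x ∷ xs) = begin
    v x * wedge w φ xs - wedge v (λ ys → w x * φ ys - wedge w (φ ∘ (x ∷_)) ys) xs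
      ≈⟨ +-congˡ (-‿cong (expand v w)) ⟩
    v x * wedge w φ xs - (w x * wedge v φ xs - wedge v (wedge w φₓ) xs)
      ≈⟨ +-congˡ (-‿cong (+-congˡ (trans (-‿cong (wedge-anticomm v w φₓ xs)) (-‿involutive _)))) ⟩
    v x * wedge w φ xs - (w x * wedge v φ xs + wedge w (wedge v φₓ) xs)
      ≈⟨ rearrange _ _ _ ⟩
    - (w x * wedge v φ xs - (v x * wedge w φ xs - wedge w (wedge v φₓ) xs))
      ≈⟨ -‿cong (+-congˡ (-‿cong (expand w v))) ⟨
    - (w x * wedge v φ xs - wedge w (λ ys → v x * φ ys - wedge v (φ ∘ (x ∷_)) ys) xs) ∎
    where
    φₓ : Form
    φₓ = φ ∘ (x ∷_)
    expand : ∀ v w → wedge v (λ ys → w x * φ ys - wedge w φₓ ys) xs ≈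
      w x * wedge v φ xs - wedge v (wedge w φₓ) xs
    expand v w = trans (wedge-+ʳ v _ _ xs) (+-cong (wedge-*ʳ v _ _ xs) (wedge-neg v _ xs))
    rearrange : ∀ a b d → a - (b + d) ≈ - (b - (a - d))
    rearrange a b d = begin
      a - (b + d)         ≈⟨ +-congˡ (-‿+-comm b d) ⟨
      a + (- b + - d)     ≈⟨ x∙yz≈y∙xz a (- b) (- d) ⟩
      - b + (a - d)       ≈⟨ +-congˡ (-‿involutive (a - d)) ⟨
      - b - (- (a - d))   ≈⟨ -‿+-comm b _ ⟩
      - (b - (a - d))     ∎

  -- Anticommutativity alone would show only that twice the value is zero, and 2 may be a zero
  -- divisor in `R`; hence a separate induction.
  wedge-self : ∀ v φ xs → wedge v (wedge v φ) xs ≈ 0#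
  wedge-self v φ []       = refl
  wedge-self v φ (x ∷ xs) = begin
    v x * wedge v φ xs - wedge v (λ ys → v x * φ ys - wedge v (φ ∘ (x ∷_)) ys) xs
      ≈⟨ +-congˡ (-‿cong (trans (wedge-+ʳ v _ _ xs) (+-cong (wedge-*ʳ v _ _ xs)
           (trans (wedge-neg v _ xs) (trans (-‿cong (wedge-self v _ xs)) -0#≈0#))))) ⟩
    v x * wedge v φ xs - (v x * wedge v φ xs + 0#)
      ≈⟨ +-congˡ (-‿cong (+-identityʳ _)) ⟩
    v x * wedge v φ xs - v x * wedge v φ xs
      ≈⟨ -‿inverseʳ _ ⟩
    0# ∎

  wedges : (ℕ → Vector) → List ℕ → Form → Form
  wedges f []       φ = φ
  wedges f (p ∷ ps) φ = wedge (f p) (wedges f ps φ)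

  wedges-cong : ∀ f ps {φ ψ} → (∀ xs → φ xs ≈ ψ xs) →
    ∀ xs → wedges f ps φ xs ≈ wedges f ps ψ xs
  wedges-cong f []       p xs = p xs
  wedges-cong f (_ ∷ ps) p xs = wedge-congʳ (wedges-cong f ps p) xs

  wedges-*ʳ : ∀ f ps a φ xs → wedges f ps (λ ys → a * φ ys) xs ≈ a * wedges f ps φ xs
  wedges-*ʳ f []       a φ xs = refl
  wedges-*ʳ f (_ ∷ ps) a φ xs =
    trans (wedge-congʳ (wedges-*ʳ f ps a φ) xs) (wedge-*ʳ _ _ _ xs)

  wedges-++ : ∀ f ps qs φ → wedges f (ps ++ qs) φ ≡ wedges f ps (wedges f qs φ)
  wedges-++ f []       qs φ = ≡.refl
  wedges-++ f (p ∷ ps) qs φ = ≡.cong (wedge (f p)) (wedges-++ f ps qs φ)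

  sgn : ℕ → Carrier
  sgn k = (- 1#) ^ k

  sgn-suc-* : ∀ k x → sgn (suc k) * x ≈ - (sgn k * x)
  sgn-suc-* k x = trans (*-congʳ (-1*x≈-x _)) (sym (-‿distribˡ-* _ _))

  sgn-+ : ∀ m n → sgn (m ℕ.+ n) ≈ sgn m * sgn n
  sgn-+ zero    n = sym (*-identityˡ _)
  sgn-+ (suc m) n = trans (*-congˡ (sgn-+ m n)) (sym (*-assoc _ _ _))

  sgn-square : ∀ n → sgn n * sgn n ≈ 1#
  sgn-square zero    = *-identityˡ 1#
  sgn-square (suc n) = begin
    sgn (suc n) * sgn (suc n)         ≈⟨ sgn-suc-* n _ ⟩
    - (sgn n * (- 1# * sgn n))        ≈⟨ -‿cong (*-congˡ (-1*x≈-x _)) ⟩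
    - (sgn n * - sgn n)               ≈⟨ -‿cong (sym (-‿distribʳ-* _ _)) ⟩
    - (- (sgn n * sgn n))             ≈⟨ -‿involutive _ ⟩
    sgn n * sgn n                     ≈⟨ sgn-square n ⟩
    1#                                ∎

  sgn-double : ∀ n → sgn (n ℕ.+ n) ≈ 1#
  sgn-double n = trans (sgn-+ n n) (sgn-square n)

  sgn-cancel : ∀ n x → sgn n * (sgn n * x) ≈ x
  sgn-cancel n x = begin
    sgn n * (sgn n * x) ≈⟨ *-assoc _ _ _ ⟨
    sgn n * sgn n * x   ≈⟨ *-congʳ (sgn-square n) ⟩
    1# * x              ≈⟨ *-identityˡ x ⟩
    x                   ∎

  wedges-comm : ∀ f ps v φ xs →
    wedges f ps (wedge v φ) xs ≈ sgn (length ps) * wedge v (wedges f ps φ) xs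
  wedges-comm f []       v φ xs = sym (*-identityˡ _)
  wedges-comm f (p ∷ ps) v φ xs = begin
    wedge (f p) (wedges f ps (wedge v φ)) xs
      ≈⟨ wedge-congʳ (wedges-comm f ps v φ) xs ⟩
    wedge (f p) (λ ys → sgn k * wedge v (wedges f ps φ) ys) xs
      ≈⟨ wedge-*ʳ _ _ _ xs ⟩
    sgn k * wedge (f p) (wedge v (wedges f ps φ)) xs
      ≈⟨ *-congˡ (wedge-anticomm _ _ _ xs) ⟩
    sgn k * - wedge v (wedge (f p) (wedges f ps φ)) xs
      ≈⟨ -‿distribʳ-* _ _ ⟨
    - (sgn k * wedge v (wedge (f p) (wedges f ps φ)) xs)
      ≈⟨ sgn-suc-* k _ ⟨
    sgn (suc k) * wedge v (wedge (f p) (wedges f ps φ)) xs ∎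
    where k = length ps

  wedges-degree : ∀ f ps xs → length ps ≢ length xs → wedges f ps vac xs ≈ 0#
  wedges-degree f []       []       ne = contradiction ≡.refl ne
  wedges-degree f []       (_ ∷ _)  ne = refl
  wedges-degree f (p ∷ ps) []       ne = refl
  wedges-degree f (p ∷ ps) (x ∷ xs) ne = trans
    -- Only the length clause of `wedge-congᵖ` is wanted, so the predicate on entries is one that
    -- every entry inhabits by itself.
    (wedge-congᵖ {P = λ _ → ℕ} (f p) (x ∷ xs) (All.universal (λ x → x) (x ∷ xs)) λ ys _ len →
      wedges-degree f ps ys λ eq → ne (≡.trans (≡.cong suc eq) len))
    (wedge-zeroʳ (f p) {λ _ → 0#} (λ _ → refl) (x ∷ xs))

  ∑-cong : ∀ n {f g : Fin n → Carrier} → (∀ i → f i ≈ g i) → ∑ f ≈ ∑ g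
  ∑-cong zero    p = refl
  ∑-cong (suc n) p = +-cong (p fzero) (∑-cong n (p ∘ fsuc))

  det-cong : ∀ {n} {A B : Fin n → Fin n → Carrier} → (∀ i j → A i j ≈ B i j) → det A ≈ det B
  det-cong {zero}          p = refl
  det-cong {suc n} {A} {B} p = ∑-cong (suc n) {term A} {term B} λ j →
    *-cong (*-congˡ {sgn (toℕ j)} (p fzero j)) (det-cong λ i k → p (fsuc i) (punchIn j k))
    where
    term : (Fin (suc n) → Fin (suc n) → Carrier) → Fin (suc n) → Carrier
    term A j = (sgn (toℕ j) * A fzero j) * det (λ i → removeAt (A (fsuc i)) j)

  laplace : ∀ {n} → Vector → Form → (Fin (suc n) → ℕ) → Fin (suc n) → Carrier
  laplace v φ x j = (sgn (toℕ j) * v (x j)) * φ (tabulate (removeAt x j))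

  -- Unfolding the nested subtractions of `wedge` produces the alternating signs of the first-row
  -- expansion in `det`.
  wedge-tabulate : ∀ {n} v φ (x : Fin (suc n) → ℕ) →
    wedge v φ (tabulate x) ≈ ∑ (laplace v φ x)
  wedge-tabulate {zero}  v φ x =
    +-cong (*-congʳ (sym (*-identityˡ _))) -0#≈0#
  wedge-tabulate {suc n} v φ x = +-cong (*-congʳ (sym (*-identityˡ _))) (begin
    - wedge v φ₀ (tabulate (x ∘ fsuc))
      ≈⟨ -‿cong (wedge-tabulate v φ₀ (x ∘ fsuc)) ⟩
    - ∑ (laplace v φ₀ (x ∘ fsuc))
      ≈⟨ ∑-neg (laplace v φ₀ (x ∘ fsuc)) ⟨
    ∑ (λ j → - laplace v φ₀ (x ∘ fsuc) j)
      ≈⟨ ∑-cong (suc n) {λ j → - laplace v φ₀ (x ∘ fsuc) j} {laplace v φ x ∘ fsuc} (λ j →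
           trans (-‿distribˡ-* _ _) (*-congʳ (sym (sgn-suc-* (toℕ j) (v (x (fsuc j))))))) ⟩
    ∑ (laplace v φ x ∘ fsuc) ∎)
    where
    φ₀ : Form
    φ₀ = φ ∘ (x fzero ∷_)

  -- Expanding along the first row is wedging with the covector of that row, so the two recursions
  -- coincide.
  det-tabulate : ∀ n f (p : ℕ → ℕ) (x : Fin n → ℕ) →
    det (λ i j → f (p (toℕ i)) (x j)) ≈ wedges f (applyUpTo p n) vac (tabulate x)
  det-tabulate zero    f p x = refl
  det-tabulate (suc n) f p x = trans
    (∑-cong (suc n)
      {λ j → (sgn (toℕ j) * f (p 0) (x j)) *
        det (λ (i k : Fin n) → f (p (suc (toℕ i))) (removeAt x j k))}
      {laplace (f (p 0)) (wedges f (applyUpTo (p ∘ suc) n) vac) x}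
      λ j → *-congˡ (det-tabulate n f (p ∘ suc) (removeAt x j)))
    (sym (wedge-tabulate (f (p 0)) (wedges f (applyUpTo (p ∘ suc) n) vac) x))

  tabulate-toℕ : ∀ (x : ℕ → ℕ) n → tabulate {n = n} (x ∘ toℕ) ≡ applyUpTo x n
  tabulate-toℕ x zero    = ≡.refl
  tabulate-toℕ x (suc n) = ≡.cong (x 0 ∷_) (tabulate-toℕ (x ∘ suc) n)

  det-wedges : ∀ n f (p x : ℕ → ℕ) →
    det {n} (λ i j → f (p (toℕ i)) (x (toℕ j))) ≈ wedges f (applyUpTo p n) vac (applyUpTo x n)
  det-wedges n f p x = trans (det-tabulate n f p (x ∘ toℕ))
    (reflexive (≡.cong (wedges f (applyUpTo p n) vac) (tabulate-toℕ x n)))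

-- Interior products and dual bases.

module Contractions {c ℓ} (R : CommutativeRing c ℓ) where
  open CommutativeRing R hiding (zero)
  open SemiringSum semiring using (∑-distrib-+; *-distribˡ-sum; *-distribʳ-sum)
    renaming (sum to ∑)
  open RingProperties ring
  open CommutativeSemigroupProperties
    (CommutativeMonoid.commutativeSemigroup *-commutativeMonoid) using ()
    renaming (x∙yz≈y∙xz to x*yz≈y*xz)
  open SetoidReasoning setoid
  open Forms R

  -- The Kronecker delta, read as the coordinate covector of a position. Recursion on both indices
  -- lets `ε (suc v) (suc x)` reduce to `ε v x` without deciding an equality.
  ε : ℕ → Vector
  ε zero    zero    = 1#
  ε zero    (suc x) = 0#
  ε (suc v) zero    = 0#
  ε (suc v) (suc x) = ε v x

  ε-same : ∀ v → ε v v ≈ 1#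
  ε-same zero    = refl
  ε-same (suc v) = ε-same v

  ε-diff : ∀ {v x} → v ≢ x → ε v x ≈ 0#
  ε-diff {zero}  {zero}  v≢x = contradiction ≡.refl v≢x
  ε-diff {zero}  {suc x} v≢x = refl
  ε-diff {suc v} {zero}  v≢x = refl
  ε-diff {suc v} {suc x} v≢x = ε-diff (v≢x ∘ ≡.cong suc)

  ε-sym : ∀ v x → ε v x ≈ ε x v
  ε-sym zero    zero    = refl
  ε-sym zero    (suc x) = refl
  ε-sym (suc v) zero    = refl
  ε-sym (suc v) (suc x) = ε-sym v x

  ∑-ε-< : ∀ {n v} (w : Vector) → v ℕ.< n →
    ∑ {n} (λ i → ε v (toℕ i) * w (toℕ i)) ≈ w v
  ∑-ε-< {suc n} {zero}  w _         = trans
    (+-cong (*-identityˡ _) (∑-zero {n} λ i → zeroˡ (w (suc (toℕ i))))) (+-identityʳ _)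
  ∑-ε-< {suc n} {suc v} w (s<s v<n) = trans
    (+-cong (zeroˡ _) (∑-ε-< (w ∘ suc) v<n)) (+-identityˡ _)

  ∑-ε-≥ : ∀ {n v} (w : Vector) → n ℕ.≤ v →
    ∑ {n} (λ i → ε v (toℕ i) * w (toℕ i)) ≈ 0#
  ∑-ε-≥ {n} {v} w n≤v = ∑-zero {n} λ i → trans
    (*-congʳ (ε-diff λ eq → ℕ.<⇒≱ (toℕ<n i) (≡.subst (n ℕ.≤_) eq n≤v))) (zeroˡ (w (toℕ i)))

  wedge-vanish : ∀ {v} φ xs → All (λ x → v x ≈ 0#) xs → wedge v φ xs ≈ 0#
  wedge-vanish φ []       []       = refl
  wedge-vanish φ (x ∷ xs) (p ∷ ps) = trans
    (+-cong (trans (*-congʳ p) (zeroˡ _)) (trans (-‿cong (wedge-vanish _ xs ps)) -0#≈0#))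
    (+-identityˡ 0#)

  wedges-ε-same : ∀ xs → Unique xs → wedges ε xs vac xs ≈ 1#
  wedges-ε-same []       []        = refl
  wedges-ε-same (x ∷ xs) (x∉ ∷ xs!) = begin
    ε x x * wedges ε xs vac xs - wedge (ε x) (wedges ε xs vac ∘ (x ∷_)) xs
      ≈⟨ +-cong (*-cong (ε-same x) (wedges-ε-same xs xs!))
           (-‿cong (wedge-vanish _ xs (All.map ε-diff x∉))) ⟩
    1# * 1# - 0# ≈⟨ +-cong (*-identityˡ 1#) -0#≈0# ⟩
    1# + 0#      ≈⟨ +-identityʳ 1# ⟩
    1#           ∎

  -- The two covectors take arguments from different lists, so no sign appears.
  wedge-swap : ∀ v g (Ψ : List ℕ → Form) vs ys →
    wedge v (λ ys → wedge g (λ vs → Ψ vs ys) vs) ys ≈ wedge g (λ vs → wedge v (Ψ vs) ys) vs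
  wedge-swap v g Ψ []       ys = wedge-zeroʳ v (λ _ → refl) ys
  wedge-swap v g Ψ (x ∷ vs) ys = trans (wedge-+ʳ v _ _ ys) (+-cong
    (wedge-*ʳ v _ _ ys)
    (trans (wedge-neg v _ ys) (-‿cong (wedge-swap v g (Ψ ∘ (x ∷_)) vs ys))))

  module _ (n : ℕ) where

    pairing : Vector → Vector → Carrier
    pairing v g = ∑ {n} λ i → v (toℕ i) * g (toℕ i)

    -- The interior product: the vector fills the first argument, and only its first `n` coordinates
    -- enter.
    contract : Vector → Form → Form
    contract g φ xs = ∑ {n} λ i → g (toℕ i) * φ (toℕ i ∷ xs)

    contract-cong : ∀ g {φ ψ} → (∀ xs → φ xs ≈ ψ xs) → ∀ xs → contract g φ xs ≈ contract g ψ xs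
    contract-cong g p xs = ∑-cong n λ i → *-congˡ {g (toℕ i)} (p (toℕ i ∷ xs))

    contract-+ : ∀ g φ ψ xs → contract g (λ ys → φ ys + ψ ys) xs ≈ contract g φ xs + contract g ψ xs
    contract-+ g φ ψ xs = trans
      (∑-cong n λ i → distribˡ (g (toℕ i)) (φ (toℕ i ∷ xs)) (ψ (toℕ i ∷ xs)))
      (∑-distrib-+ {n} (λ i → g (toℕ i) * φ (toℕ i ∷ xs)) (λ i → g (toℕ i) * ψ (toℕ i ∷ xs)))

    contract-* : ∀ g a φ xs → contract g (λ ys → a * φ ys) xs ≈ a * contract g φ xs
    contract-* g a φ xs = trans
      (∑-cong n λ i → x*yz≈y*xz (g (toℕ i)) a (φ (toℕ i ∷ xs)))
      (sym (*-distribˡ-sum {n} a (λ i → g (toℕ i) * φ (toℕ i ∷ xs))))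

    -- The antiderivation rule. For a coordinate vector it is the defining equation of `wedge` on a
    -- nonempty list; linearity in `g` does the rest.
    contract-wedge : ∀ g v φ xs →
      contract g (wedge v φ) xs ≈ pairing v g * φ xs - wedge v (contract g φ) xs
    contract-wedge g v φ xs = begin
      ∑ (λ i → G i * (V i * φ xs - W i))
        ≈⟨ ∑-cong n (λ i → trans (distribˡ (G i) _ _) (+-cong
             (trans (sym (*-assoc _ _ _)) (*-congʳ (*-comm (G i) (V i))))
             (sym (-‿distribʳ-* (G i) (W i))))) ⟩
      ∑ (λ i → (V i * G i) * φ xs + - (G i * W i))
        ≈⟨ ∑-distrib-+ {n} (λ i → (V i * G i) * φ xs) (λ i → - (G i * W i)) ⟩
      ∑ (λ i → (V i * G i) * φ xs) + ∑ (λ i → - (G i * W i))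
        ≈⟨ +-cong (sym (*-distribʳ-sum {n} (φ xs) (λ i → V i * G i)))
             (∑-neg (λ i → G i * W i)) ⟩
      pairing v g * φ xs - ∑ (λ i → G i * W i)
        ≈⟨ +-congˡ (-‿cong (trans (wedge-∑ʳ {n} v (λ i ys → G i * φ (toℕ i ∷ ys)) xs)
             (∑-cong n λ i → wedge-*ʳ v (G i) (φ ∘ (toℕ i ∷_)) xs))) ⟨
      pairing v g * φ xs - wedge v (contract g φ) xs ∎
      where
      G V W : Fin n → Carrier
      G i = g (toℕ i)
      V i = v (toℕ i)
      W i = wedge v (φ ∘ (toℕ i ∷_)) xs

    -- The head of the list contracts first and so meets the outermost factor of `wedges`; this is
    -- why matching lists cancel without a sign.
    contracts : (ℕ → Vector) → List ℕ → Form → Form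
    contracts g []       φ = φ
    contracts g (u ∷ us) φ = contracts g us (contract (g u) φ)

    contracts-cong : ∀ g us {φ ψ} → (∀ xs → φ xs ≈ ψ xs) →
      ∀ xs → contracts g us φ xs ≈ contracts g us ψ xs
    contracts-cong g []       p = p
    contracts-cong g (u ∷ us) p = contracts-cong g us (contract-cong (g u) p)

    contracts-+ : ∀ g us φ ψ xs →
      contracts g us (λ ys → φ ys + ψ ys) xs ≈ contracts g us φ xs + contracts g us ψ xs
    contracts-+ g []       φ ψ xs = refl
    contracts-+ g (u ∷ us) φ ψ xs =
      trans (contracts-cong g us (contract-+ (g u) φ ψ) xs) (contracts-+ g us _ _ xs)

    contracts-* : ∀ g us a φ xs → contracts g us (λ ys → a * φ ys) xs ≈ a * contracts g us φ xs
    contracts-* g []       a φ xs = refl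
    contracts-* g (u ∷ us) a φ xs =
      trans (contracts-cong g us (contract-* (g u) a φ) xs) (contracts-* g us a _ xs)

    contracts-wedge : ∀ g us w (Ψ : List ℕ → Form) vs xs →
      contracts g us (λ ys → wedge w (λ vs → Ψ vs ys) vs) xs ≈
      wedge w (λ vs → contracts g us (Ψ vs) xs) vs
    contracts-wedge g []       w Ψ vs xs = refl
    contracts-wedge g (u ∷ us) w Ψ vs xs = trans
      (contracts-cong g us (λ ys → sym (trans
        (wedge-∑ʳ {n} w (λ i vs → g u (toℕ i) * Ψ vs (toℕ i ∷ ys)) vs)
        (∑-cong n λ i → wedge-*ʳ w (g u (toℕ i)) (λ vs → Ψ vs (toℕ i ∷ ys)) vs))) xs)
      (contracts-wedge g us w (λ vs → contract (g u) (Ψ vs)) vs xs)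

    contract-orthogonal : ∀ {f} g ps → All (λ p → pairing (f p) g ≈ 0#) ps →
      ∀ xs → contract g (wedges f ps vac) xs ≈ 0#
    contract-orthogonal g []      []       xs = ∑-zero {n} λ i → zeroʳ (g (toℕ i))
    contract-orthogonal {f} g (p ∷ ps) (o ∷ os) xs = begin
      contract g (wedge (f p) (wedges f ps vac)) xs
        ≈⟨ contract-wedge g (f p) (wedges f ps vac) xs ⟩
      pairing (f p) g * wedges f ps vac xs - wedge (f p) (contract g (wedges f ps vac)) xs
        ≈⟨ +-cong (trans (*-congʳ o) (zeroˡ _))
             (trans (-‿cong (wedge-zeroʳ (f p) (contract-orthogonal g ps os) xs)) -0#≈0#) ⟩
      0# + 0#
        ≈⟨ +-identityˡ 0# ⟩
      0# ∎

    contract-dual : ∀ {f} g p ps → pairing (f p) g ≈ 1# → All (λ p → pairing (f p) g ≈ 0#) ps →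
      ∀ xs → contract g (wedges f (p ∷ ps) vac) xs ≈ wedges f ps vac xs
    contract-dual {f} g p ps o os xs = begin
      contract g (wedge (f p) (wedges f ps vac)) xs
        ≈⟨ contract-wedge g (f p) (wedges f ps vac) xs ⟩
      pairing (f p) g * wedges f ps vac xs - wedge (f p) (contract g (wedges f ps vac)) xs
        ≈⟨ +-cong (trans (*-congʳ o) (*-identityˡ _))
             (trans (-‿cong (wedge-zeroʳ (f p) (contract-orthogonal g ps os) xs)) -0#≈0#) ⟩
      wedges f ps vac xs + 0#
        ≈⟨ +-identityʳ _ ⟩
      wedges f ps vac xs ∎

    -- Each `g u` strips the leading factor `f u`; the terms in which it would hit a later factor
    -- vanish, because all later positions differ from `u`.
    contracts-dual : ∀ {f g} →
      (∀ {p u} → p ℕ.< n → u ℕ.< n → pairing (f p) (g u) ≈ ε p u) →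
      ∀ us ps → Unique (us ++ ps) → All (ℕ._< n) (us ++ ps) →
      ∀ xs → contracts g us (wedges f (us ++ ps) vac) xs ≈ wedges f ps vac xs
    contracts-dual o []       ps _         _         xs = refl
    contracts-dual {f} {g} o (u ∷ us) ps (u∉ ∷ us!) (u<n ∷ us<n) xs = trans
      (contracts-cong g us (contract-dual (g u) u (us ++ ps) (trans (o u<n u<n) (ε-same u))
        (All.zipWith (λ (u≢p , p<n) → trans (o p<n u<n) (ε-diff (u≢p ∘ ≡.sym))) (u∉ , us<n))) xs)
      (contracts-dual o us ps us! us<n xs)

    -- Either `g` hits one of the `ε v`, or it passes all of them and reaches `χ`. Hitting `ε v`
    -- yields the coordinate `g v`, so the terms of the first kind form a wedge with `g` in which
    -- the index list `vs` has become the list of arguments.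
    contract-wedges-ε : ∀ g vs → All (ℕ._< n) vs → ∀ χ xs →
      contract g (wedges ε vs χ) xs ≈
      wedge g (λ ws → wedges ε ws χ xs) vs + sgn (length vs) * wedges ε vs (contract g χ) xs
    contract-wedges-ε g []       []           χ xs = sym (trans (+-identityˡ _) (*-identityˡ _))
    contract-wedges-ε g (v ∷ vs) (v<n ∷ vs<n) χ xs = begin
      contract g (wedge (ε v) (wedges ε vs χ)) xs
        ≈⟨ contract-wedge g (ε v) (W vs) xs ⟩
      pairing (ε v) g * W vs xs - wedge (ε v) (contract g (W vs)) xs
        ≈⟨ +-cong (*-congʳ (∑-ε-< g v<n))
             (-‿cong (wedge-congʳ (contract-wedges-ε g vs vs<n χ) xs)) ⟩
      g v * W vs xs - wedge (ε v) (λ ys → wedge g (λ ws → W ws ys) vs + s * X ys) xs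
        ≈⟨ +-congˡ (-‿cong (trans (wedge-+ʳ (ε v) _ _ xs)
             (+-cong (wedge-swap (ε v) g W vs xs) (wedge-*ʳ (ε v) s X xs)))) ⟩
      g v * W vs xs - (wedge g (λ ws → W (v ∷ ws) xs) vs + s * wedge (ε v) X xs)
        ≈⟨ +-congˡ (-‿+-comm _ _) ⟨
      g v * W vs xs + (- wedge g (λ ws → W (v ∷ ws) xs) vs + - (s * wedge (ε v) X xs))
        ≈⟨ +-assoc _ _ _ ⟨
      (g v * W vs xs - wedge g (λ ws → W (v ∷ ws) xs) vs) + - (s * wedge (ε v) X xs)
        ≈⟨ +-congˡ (sgn-suc-* (length vs) _) ⟨
      (g v * W vs xs - wedge g (λ ws → W (v ∷ ws) xs) vs) + sgn (suc (length vs)) * wedge (ε v) X xs ∎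
      where
      s = sgn (length vs)
      W : List ℕ → Form
      W ws = wedges ε ws χ
      X : Form
      X = wedges ε vs (contract g χ)

    -- At arguments disjoint from `vs` every remaining `ε v` evaluates to zero, so the contractions
    -- must consume all of them and none is left for `χ`; the result carries the minor of `g` with
    -- rows `us` and columns `vs`. Allowing fewer contractions than factors, where both sides
    -- vanish, keeps the induction closed under spending a contraction on `χ`.
    contracts-wedges-ε : ∀ g xs us vs χ → length us ℕ.≤ length vs →
      All (λ v → v ℕ.< n × All (v ≢_) xs) vs →
      contracts g us (wedges ε vs χ) xs ≈ wedges g us vac vs * χ xs
    contracts-wedges-ε g xs []       []       χ _ _ = sym (*-identityˡ _)
    contracts-wedges-ε g xs []       (v ∷ vs) χ _ ((_ , v∉) ∷ _) = trans
      (wedge-vanish _ xs (All.map ε-diff v∉)) (sym (zeroˡ _))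
    contracts-wedges-ε g xs (u ∷ us) vs@(_ ∷ ws) χ (s≤s le) ps = begin
      contracts g us (contract (g u) (W vs)) xs
        ≈⟨ contracts-cong g us (contract-wedges-ε (g u) vs (All.map proj₁ ps) χ) xs ⟩
      contracts g us (λ ys → wedge (g u) (λ ws → W ws ys) vs + s * X ys) xs
        ≈⟨ contracts-+ g us _ _ xs ⟩
      contracts g us (λ ys → wedge (g u) (λ ws → W ws ys) vs) xs + contracts g us (λ ys → s * X ys) xs
        ≈⟨ +-cong (contracts-wedge g us (g u) W vs xs) (contracts-* g us s X xs) ⟩
      wedge (g u) (λ ws → contracts g us (W ws) xs) vs + s * contracts g us X xs
        ≈⟨ +-cong
             (wedge-congᵖ (g u) vs ps λ ys pys len → trans
               (contracts-wedges-ε g xs us ys χ (≡.subst (length us ℕ.≤_) (≡.sym (ℕ.suc-injective len)) le) pys)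
               (*-comm _ _))
             (*-congˡ (contracts-wedges-ε g xs us vs (contract (g u) χ) (ℕ.m≤n⇒m≤1+n le) ps)) ⟩
      wedge (g u) (λ ws → χ xs * wedges g us vac ws) vs + s * (wedges g us vac vs * contract (g u) χ xs)
        ≈⟨ +-cong (wedge-*ʳ (g u) (χ xs) (wedges g us vac) vs)
             -- Once `g u` is spent on `χ`, fewer contractions than factors remain, and the minor
             -- vanishes by degree.
             (*-congˡ (*-congʳ (wedges-degree g us vs (ℕ.<⇒≢ (s≤s le))))) ⟩
      χ xs * wedges g (u ∷ us) vac vs + s * (0# * contract (g u) χ xs)
        ≈⟨ +-cong (*-comm _ _) (trans (*-congˡ (zeroˡ _)) (zeroʳ s)) ⟩
      wedges g (u ∷ us) vac vs * χ xs + 0#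
        ≈⟨ +-identityʳ _ ⟩
      wedges g (u ∷ us) vac vs * χ xs ∎
      where
      s = sgn (length vs)
      W : List ℕ → Form
      W ws = wedges ε ws χ
      X : Form
      X = wedges ε vs (contract (g u) χ)

-- Finite lists, and positions on the boundary of a Young diagram.

applyUpTo-cong : ∀ {a} {A : Set a} {f g : ℕ → A} n → (∀ {i} → i ℕ.< n → f i ≡ g i) →
  applyUpTo f n ≡ applyUpTo g n
applyUpTo-cong zero    p = ≡.refl
applyUpTo-cong (suc n) p = ≡.cong₂ _∷_ (p z<s) (applyUpTo-cong n (p ∘ s<s))

applyUpTo-downFrom : ∀ n → applyUpTo (λ i → n ℕ.∸ suc i) n ≡ downFrom n
applyUpTo-downFrom zero    = ≡.refl
applyUpTo-downFrom (suc n) = ≡.cong (n ∷_) (applyUpTo-downFrom n)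

sum-applyUpTo-suc : ∀ f n → sum (applyUpTo f (suc n)) ≡ sum (applyUpTo f n) ℕ.+ f n
sum-applyUpTo-suc f n = ≡.trans
  (≡.cong sum (≡.sym (applyUpTo-∷ʳ f n)))
  (≡.trans (sum-++ (applyUpTo f n) (f n ∷ [])) (≡.cong (sum (applyUpTo f n) ℕ.+_) (ℕ.+-identityʳ _)))

sum-applyUpTo-+ : ∀ {f g h : ℕ → ℕ} n → (∀ i → f i ℕ.+ g i ≡ h i) →
  sum (applyUpTo f n) ℕ.+ sum (applyUpTo g n) ≡ sum (applyUpTo h n)
sum-applyUpTo-+ zero    p = ≡.refl
sum-applyUpTo-+ {f} {g} {h} (suc n) p = begin
  (f 0 ℕ.+ sf) ℕ.+ (g 0 ℕ.+ sg) ≡⟨ ℕ.+-assoc (f 0) sf _ ⟩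
  f 0 ℕ.+ (sf ℕ.+ (g 0 ℕ.+ sg)) ≡⟨ ≡.cong (f 0 ℕ.+_) (ℕ.+-assoc sf (g 0) sg) ⟨
  f 0 ℕ.+ ((sf ℕ.+ g 0) ℕ.+ sg) ≡⟨ ≡.cong (λ t → f 0 ℕ.+ (t ℕ.+ sg)) (ℕ.+-comm sf (g 0)) ⟩
  f 0 ℕ.+ ((g 0 ℕ.+ sf) ℕ.+ sg) ≡⟨ ≡.cong (f 0 ℕ.+_) (ℕ.+-assoc (g 0) sf sg) ⟩
  f 0 ℕ.+ (g 0 ℕ.+ (sf ℕ.+ sg)) ≡⟨ ℕ.+-assoc (f 0) (g 0) _ ⟨
  (f 0 ℕ.+ g 0) ℕ.+ (sf ℕ.+ sg) ≡⟨ ≡.cong₂ ℕ._+_ (p 0) (sum-applyUpTo-+ n (p ∘ suc)) ⟩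
  h 0 ℕ.+ sum (applyUpTo (h ∘ suc) n) ∎
  where
  open ≡.≡-Reasoning
  sf = sum (applyUpTo (f ∘ suc) n)
  sg = sum (applyUpTo (g ∘ suc) n)

-- Row lengths r and column lengths c of a diagram with at most N rows and M columns.
record Conjugate (r c : ℕ → ℕ) (N M : ℕ) : Set where
  field
    row⇒col : ∀ {i j} → j ℕ.< r i → i ℕ.< c j
    col⇒row : ∀ {i j} → i ℕ.< c j → j ℕ.< r i
    r≤M     : ∀ i → r i ℕ.≤ M
    c≤N     : ∀ j → c j ℕ.≤ N

module Boundary {r cl : ℕ → ℕ} {N M₀ : ℕ} (conj : Conjugate r cl N M₀) where
  open Conjugate conj
  open ℕ.≤-Reasoning

  -- The positions of the vertical steps of the boundary of the diagram
  -- truncated to its first M columns, and those of the horizontal steps.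
  rowPos : ℕ → ℕ → ℕ
  rowPos M i = (N ℕ.+ (r i ℕ.⊓ M)) ℕ.∸ suc i

  colPos : ℕ → ℕ
  colPos j = (N ℕ.+ j) ℕ.∸ cl j

  -- Tracks what one more column does: rows above `cl M` move up by one place, into the place of
  -- their predecessor, and the others stay. So `rowPos (suc M)` is `prefix M` with entry number
  -- `cl M` left out, and that entry is `colPos M`.
  prefix : ℕ → ℕ → ℕ
  prefix M zero    = N ℕ.+ M
  prefix M (suc i) = rowPos M i

  prefix-< : ∀ M i → i ℕ.≤ cl M → prefix M i ≡ (N ℕ.+ M) ℕ.∸ i
  prefix-< M zero    _  = ≡.refl
  prefix-< M (suc i) lt = ≡.cong (λ t → (N ℕ.+ t) ℕ.∸ suc i) (ℕ.m≥n⇒m⊓n≡n (ℕ.<⇒≤ (col⇒row lt)))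

  rowPos-< : ∀ M {i} → i ℕ.< cl M → rowPos (suc M) i ≡ prefix M i
  rowPos-< M {i} lt = ≡.trans
    (≡.cong (ℕ._∸ suc i) (≡.trans (≡.cong (N ℕ.+_) (ℕ.m≥n⇒m⊓n≡n (col⇒row lt))) (ℕ.+-suc N M)))
    (≡.sym (prefix-< M i (ℕ.<⇒≤ lt)))

  rowPos-≥ : ∀ M {i} → cl M ℕ.≤ i → rowPos (suc M) i ≡ rowPos M i
  rowPos-≥ M {i} le = ≡.cong (λ t → (N ℕ.+ t) ℕ.∸ suc i)
    (≡.trans (ℕ.m≤n⇒m⊓n≡m (ℕ.m≤n⇒m≤1+n r≤)) (≡.sym (ℕ.m≤n⇒m⊓n≡m r≤)))
    where
    r≤ : r i ℕ.≤ M
    r≤ = ℕ.≮⇒≥ λ lt → ℕ.<⇒≱ (row⇒col lt) le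

  positions-< : All (ℕ._< N ℕ.+ M₀) (applyUpTo colPos M₀ ++ applyUpTo (rowPos M₀) N)
  positions-< = All.++⁺
    (All.applyUpTo⁺₁ colPos M₀ λ {j} j<M → ℕ.≤-<-trans (ℕ.m∸n≤m (N ℕ.+ j) (cl j)) (ℕ.+-monoʳ-< N j<M))
    (All.applyUpTo⁺₁ (rowPos M₀) N λ {i} i<N → ℕ.<-≤-trans
      (ℕ.∸-monoʳ-< {m = N ℕ.+ (r i ℕ.⊓ M₀)} {n = suc i} {o = 0} z<s (ℕ.≤-trans i<N (ℕ.m≤m+n N _)))
      (ℕ.+-monoʳ-≤ N (ℕ.m⊓n≤n (r i) M₀)))

  c-anti : ∀ {i j} → i ℕ.≤ j → cl j ℕ.≤ cl i
  c-anti {i} {j} i≤j = ℕ.≮⇒≥ λ lt → ℕ.<-irrefl ≡.refl (row⇒col (ℕ.≤-<-trans i≤j (col⇒row lt)))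

  r-anti : ∀ {i j} → i ℕ.≤ j → r j ℕ.≤ r i
  r-anti {i} {j} i≤j = ℕ.≮⇒≥ λ lt → ℕ.<-irrefl ≡.refl (col⇒row (ℕ.≤-<-trans i≤j (row⇒col lt)))

  colPos+ : ∀ j → colPos j ℕ.+ cl j ≡ N ℕ.+ j
  colPos+ j = ℕ.m∸n+n≡m (ℕ.≤-trans (c≤N j) (ℕ.m≤m+n N j))

  rowPos+ : ∀ {i} → i ℕ.< N → rowPos M₀ i ℕ.+ suc i ≡ N ℕ.+ r i
  rowPos+ {i} i<N = ≡.trans (ℕ.m∸n+n≡m (ℕ.≤-trans i<N (ℕ.m≤m+n N _)))
    (≡.cong (N ℕ.+_) (ℕ.m≤n⇒m⊓n≡m (r≤M i)))

  colPos≢ : ∀ {i j} → i ℕ.< j → colPos i ≢ colPos j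
  colPos≢ {i} {j} i<j eq = ℕ.<-irrefl ≡.refl (begin-strict
    N ℕ.+ i           <⟨ ℕ.+-monoʳ-< N i<j ⟩
    N ℕ.+ j           ≡⟨ colPos+ j ⟨
    colPos j ℕ.+ cl j ≤⟨ ℕ.+-monoʳ-≤ (colPos j) (c-anti (ℕ.<⇒≤ i<j)) ⟩
    colPos j ℕ.+ cl i ≡⟨ ≡.cong (ℕ._+ cl i) eq ⟨
    colPos i ℕ.+ cl i ≡⟨ colPos+ i ⟩
    N ℕ.+ i           ∎)

  rowPos≢ : ∀ {i j} → i ℕ.< j → j ℕ.< N → rowPos M₀ i ≢ rowPos M₀ j
  rowPos≢ {i} {j} i<j j<N eq = ℕ.<-irrefl ≡.refl (begin-strict
    rowPos M₀ i ℕ.+ suc i <⟨ ℕ.+-monoʳ-< (rowPos M₀ i) (s<s i<j) ⟩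
    rowPos M₀ i ℕ.+ suc j ≡⟨ ≡.cong (ℕ._+ suc j) eq ⟩
    rowPos M₀ j ℕ.+ suc j ≡⟨ rowPos+ j<N ⟩
    N ℕ.+ r j             ≤⟨ ℕ.+-monoʳ-≤ N (r-anti (ℕ.<⇒≤ i<j)) ⟩
    N ℕ.+ r i             ≡⟨ rowPos+ (ℕ.<-trans i<j j<N) ⟨
    rowPos M₀ i ℕ.+ suc i ∎)

  hook : ∀ {i j} → colPos j ≡ rowPos M₀ i → i ℕ.< N → r i ℕ.+ cl j ≡ j ℕ.+ suc i
  hook {i} {j} eq i<N = ℕ.+-cancelˡ-≡ (N ℕ.+ colPos j) _ _ (begin-equality
    (N ℕ.+ colPos j) ℕ.+ (r i ℕ.+ cl j)    ≡⟨ interchange N (colPos j) (r i) (cl j) ⟩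
    (N ℕ.+ r i) ℕ.+ (colPos j ℕ.+ cl j)    ≡⟨ ≡.cong₂ ℕ._+_ (≡.sym (rowPos+ i<N)) (colPos+ j) ⟩
    (rowPos M₀ i ℕ.+ suc i) ℕ.+ (N ℕ.+ j)  ≡⟨ ≡.cong (λ p → (p ℕ.+ suc i) ℕ.+ (N ℕ.+ j)) eq ⟨
    (colPos j ℕ.+ suc i) ℕ.+ (N ℕ.+ j)     ≡⟨ ℕ.+-comm (colPos j ℕ.+ suc i) _ ⟩
    (N ℕ.+ j) ℕ.+ (colPos j ℕ.+ suc i)     ≡⟨ interchange N j (colPos j) (suc i) ⟩
    (N ℕ.+ colPos j) ℕ.+ (j ℕ.+ suc i)     ∎)
    where open CommutativeSemigroupProperties ℕ.+-commutativeSemigroup using (interchange)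

  -- Equality would make the hook length r i + c j - i - j - 1 vanish.
  colPos≢rowPos : ∀ {i j} → i ℕ.< N → colPos j ≢ rowPos M₀ i
  colPos≢rowPos {i} {j} i<N eq with j ℕ.<? r i
  ... | yes j<r = ℕ.<-irrefl (≡.sym balance) (ℕ.+-mono-<-≤ j<r (row⇒col j<r))
    where balance = hook eq i<N
  ... | no j≮r  = ℕ.<-irrefl balance (ℕ.+-mono-≤-< (ℕ.≮⇒≥ j≮r) (s<s (ℕ.≮⇒≥ λ i<c → j≮r (col⇒row i<c))))
    where balance = hook eq i<N

  positions-unique : Unique (applyUpTo colPos M₀ ++ applyUpTo (rowPos M₀) N)
  positions-unique = AllPairs.++⁺
    (AllPairs.applyUpTo⁺₁ colPos M₀ λ i<j _ → colPos≢ i<j)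
    (AllPairs.applyUpTo⁺₁ (rowPos M₀) N rowPos≢)
    (All.applyUpTo⁺₁ colPos M₀ λ _ → All.applyUpTo⁺₁ (rowPos M₀) N colPos≢rowPos)

-- The sign of sorting the boundary positions.

module Shuffle {c ℓ} (R : CommutativeRing c ℓ) where
  open CommutativeRing R hiding (zero)
  open RingProperties ring
  open CommutativeSemigroupProperties
    (CommutativeMonoid.commutativeSemigroup *-commutativeMonoid) using ()
    renaming (x∙yz≈y∙xz to x*yz≈y*xz)
  open SetoidReasoning setoid
  open Forms R
  open Contractions R

  -- `P` is `t` without its entry `k`, and the new factor passes the `k` factors that belong before
  -- it.
  wedges-insert : ∀ f φ t P n k → k ℕ.≤ n →
    (∀ {i} → i ℕ.< k → P i ≡ t i) → (∀ {i} → k ℕ.≤ i → P i ≡ t (suc i)) → ∀ xs →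
    wedge (f (t k)) (wedges f (applyUpTo P n) φ) xs ≈ sgn k * wedges f (applyUpTo t (suc n)) φ xs
  wedges-insert f φ t P n zero _ _ P≥ xs = trans
    (reflexive (≡.cong (λ ps → wedges f (t 0 ∷ ps) φ xs) (applyUpTo-cong n λ {i} _ → P≥ {i} z≤n)))
    (sym (*-identityˡ _))
  wedges-insert f φ t P (suc n) (suc k) (s≤s k≤n) P< P≥ xs = begin
    wedge (f (t (suc k))) (wedge (f (P 0)) W) xs
      ≈⟨ reflexive (≡.cong (λ p → wedge (f (t (suc k))) (wedge (f p) W) xs) (P< z<s)) ⟩
    wedge (f (t (suc k))) (wedge (f (t 0)) W) xs
      ≈⟨ wedge-anticomm _ _ _ xs ⟩
    - wedge (f (t 0)) (wedge (f (t (suc k))) W) xs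
      ≈⟨ -‿cong (wedge-congʳ (wedges-insert f φ (t ∘ suc) (P ∘ suc) n k k≤n (P< ∘ s<s) (P≥ ∘ s≤s)) xs) ⟩
    - wedge (f (t 0)) (λ ys → sgn k * wedges f (applyUpTo (t ∘ suc) (suc n)) φ ys) xs
      ≈⟨ -‿cong (wedge-*ʳ _ _ _ xs) ⟩
    - (sgn k * wedge (f (t 0)) (wedges f (applyUpTo (t ∘ suc) (suc n)) φ) xs)
      ≈⟨ sgn-suc-* k _ ⟨
    sgn (suc k) * wedges f (applyUpTo t (suc (suc n))) φ xs ∎
    where W = wedges f (applyUpTo (P ∘ suc) n) φ

  module _ {r cl : ℕ → ℕ} {N M₀ : ℕ} (conj : Conjugate r cl N M₀) where
    open Conjugate conj
    open Boundary conj

    -- Induction on the number of columns. Inserting `colPos M` completes the row positions to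
    -- `prefix M` by `cl M` transpositions, so the sign counts the cells of the first `M` columns.
    -- The new top position `N + M` is then parked inside `φ`, so that the induction hypothesis
    -- applies, and brought back; both ways it passes `N` factors, and the signs cancel.
    wedges-shuffle : ∀ f M φ xs →
      wedges f (applyUpTo colPos M) (wedges f (applyUpTo (rowPos M) N) φ) xs ≈
      sgn (sum (applyUpTo cl M)) *
        wedges f (applyUpTo (N ℕ.+_) M) (wedges f (applyUpTo (rowPos 0) N) φ) xs
    wedges-shuffle f zero    φ xs = sym (*-identityˡ _)
    wedges-shuffle f (suc M) φ xs = begin
      wedges f (applyUpTo colPos (suc M)) (wedges f (applyUpTo (rowPos (suc M)) N) φ) xs
        ≈⟨ snoc colPos _ ⟩
      wedges f us (wedge (f (colPos M)) (wedges f (applyUpTo (rowPos (suc M)) N) φ)) xs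
        ≈⟨ wedges-cong f us step xs ⟩
      wedges f us (λ ys → sgn k * wedge (f (N ℕ.+ M)) (wedges f ps φ) ys) xs
        ≈⟨ wedges-*ʳ f us _ _ xs ⟩
      sgn k * wedges f us (wedge (f (N ℕ.+ M)) (wedges f ps φ)) xs
        ≈⟨ *-congˡ (wedges-cong f us (move ps) xs) ⟩
      sgn k * wedges f us (λ ys → sgn (length ps) * wedges f ps (wedge (f (N ℕ.+ M)) φ) ys) xs
        ≈⟨ *-congˡ (wedges-*ʳ f us _ _ xs) ⟩
      sgn k * (sgn (length ps) * wedges f us (wedges f ps (wedge (f (N ℕ.+ M)) φ)) xs)
        ≈⟨ *-congˡ (*-congˡ (wedges-shuffle f M (wedge (f (N ℕ.+ M)) φ) xs)) ⟩
      sgn k * (sgn (length ps) * (sgn s * wedges f vs (wedges f qs (wedge (f (N ℕ.+ M)) φ)) xs))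
        ≈⟨ *-congˡ (x*yz≈y*xz _ _ _) ⟩
      sgn k * (sgn s * (sgn (length ps) * wedges f vs (wedges f qs (wedge (f (N ℕ.+ M)) φ)) xs))
        ≈⟨ *-congˡ (*-congˡ (trans (*-congʳ (reflexive (≡.cong sgn lengths))) (sym (wedges-*ʳ f vs _ _ xs)))) ⟩
      sgn k * (sgn s * wedges f vs (λ ys → sgn (length qs) * wedges f qs (wedge (f (N ℕ.+ M)) φ) ys) xs)
        ≈⟨ *-congˡ (*-congˡ (wedges-cong f vs (move qs) xs)) ⟨
      sgn k * (sgn s * wedges f vs (wedge (f (N ℕ.+ M)) (wedges f qs φ)) xs)
        ≈⟨ *-congˡ (*-congˡ (snoc (N ℕ.+_) _)) ⟨
      sgn k * (sgn s * wedges f (applyUpTo (N ℕ.+_) (suc M)) (wedges f qs φ) xs)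
        ≈⟨ *-assoc _ _ _ ⟨
      (sgn k * sgn s) * wedges f (applyUpTo (N ℕ.+_) (suc M)) (wedges f qs φ) xs
        ≈⟨ *-congʳ (trans (*-comm _ _) (sym (sgn-+ s k))) ⟩
      sgn (s ℕ.+ k) * wedges f (applyUpTo (N ℕ.+_) (suc M)) (wedges f qs φ) xs
        ≈⟨ *-congʳ (reflexive (≡.cong sgn (sum-applyUpTo-suc cl M))) ⟨
      sgn (sum (applyUpTo cl (suc M))) * wedges f (applyUpTo (N ℕ.+_) (suc M)) (wedges f qs φ) xs ∎
      where
      k = cl M
      s = sum (applyUpTo cl M)
      us = applyUpTo colPos M
      vs = applyUpTo (N ℕ.+_) M
      ps = applyUpTo (rowPos M) N
      qs = applyUpTo (rowPos 0) N
      lengths : length ps ≡ length qs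
      lengths = ≡.trans (length-applyUpTo (rowPos M) N) (≡.sym (length-applyUpTo (rowPos 0) N))
      snoc : ∀ g χ → wedges f (applyUpTo g (suc M)) χ xs ≈ wedges f (applyUpTo g M) (wedge (f (g M)) χ) xs
      snoc g χ = reflexive (≡.cong (λ φ → φ xs) (≡.trans
        (≡.cong (λ l → wedges f l χ) (≡.sym (applyUpTo-∷ʳ g M)))
        (wedges-++ f (applyUpTo g M) (g M ∷ []) χ)))
      move : ∀ l ys → wedge (f (N ℕ.+ M)) (wedges f l φ) ys ≈
        sgn (length l) * wedges f l (wedge (f (N ℕ.+ M)) φ) ys
      move l ys = trans (sym (sgn-cancel (length l) _)) (*-congˡ (sym (wedges-comm f l _ φ ys)))
      step : ∀ ys → wedge (f (colPos M)) (wedges f (applyUpTo (rowPos (suc M)) N) φ) ys ≈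
        sgn k * wedge (f (N ℕ.+ M)) (wedges f ps φ) ys
      step ys = trans
        (reflexive (≡.cong (λ p → wedge (f p) (wedges f (applyUpTo (rowPos (suc M)) N) φ) ys)
          (≡.sym (prefix-< M k ℕ.≤-refl))))
        (wedges-insert f φ (prefix M) (rowPos (suc M)) N k (c≤N M) (rowPos-< M) (rowPos-≥ M) ys)

-- Unitriangular bases, and checkerboard signs.

module Triangular {c ℓ} (R : CommutativeRing c ℓ) where
  open CommutativeRing R hiding (zero)
  open RingProperties ring
  open CommutativeSemigroupProperties
    (CommutativeMonoid.commutativeSemigroup *-commutativeMonoid) using ()
    renaming (interchange to *-interchange)
  open SemiringSum semiring using () renaming (sum to ∑)
  open SetoidReasoning setoid
  open Forms R
  open Contractions R

  wedge-repeated : ∀ n φ {v} → v ℕ.< n → ∀ xs → wedge (ε v) (wedges ε (downFrom n) φ) xs ≈ 0#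
  wedge-repeated (suc n) φ {v} v<n xs with ℕ.m≤n⇒m<n∨m≡n (ℕ.≤-pred v<n)
  ... | inj₂ ≡.refl = wedge-self (ε v) _ xs
  ... | inj₁ v<n′ = begin
    wedge (ε v) (wedge (ε n) W) xs   ≈⟨ wedge-anticomm _ _ W xs ⟩
    - wedge (ε n) (wedge (ε v) W) xs ≈⟨ -‿cong (wedge-zeroʳ (ε n) (wedge-repeated n φ v<n′) xs) ⟩
    - 0#                             ≈⟨ -0#≈0# ⟩
    0#                               ∎
    where W = wedges ε (downFrom n) φ

  wedges-swap : ∀ f ps v φ xs →
    wedge v (wedges f ps φ) xs ≈ sgn (length ps) * wedges f ps (wedge v φ) xs
  wedges-swap f ps v φ xs =
    trans (sym (sgn-cancel (length ps) _)) (*-congˡ (sym (wedges-comm f ps v φ xs)))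

  module _ {f : ℕ → Vector}
    (upper : ∀ {p x} → p ℕ.< x → f p x ≈ 0#) (diagonal : ∀ p → f p p ≈ 1#) where

    expand : ∀ p y → f p y ≈ ∑ {suc p} λ i → f p (toℕ i) * ε (toℕ i) y
    expand p y = sym (trans
      (∑-cong (suc p) λ i → trans (*-congˡ {f p (toℕ i)} (ε-sym (toℕ i) y)) (*-comm _ _))
      evaluate)
      where
      evaluate : ∑ {suc p} (λ i → ε y (toℕ i) * f p (toℕ i)) ≈ f p y
      evaluate with y ℕ.≤? p
      ... | yes y≤p = ∑-ε-< (f p) (s≤s y≤p)
      ... | no y≰p  = trans (∑-ε-≥ (f p) (ℕ.≰⇒> y≰p)) (sym (upper (ℕ.≰⇒> y≰p)))

    -- `f p` is `ε p` plus a combination of the `ε x` with `x` below `p`, all of which `χ`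
    -- annihilates.
    wedge-leading : ∀ p {χ} → (∀ {x} → x ℕ.< p → ∀ xs → wedge (ε x) χ xs ≈ 0#) →
      ∀ xs → wedge (f p) χ xs ≈ wedge (ε p) χ xs
    wedge-leading p {χ} kill xs = begin
      wedge (f p) χ xs
        ≈⟨ wedge-cong (expand p) (λ _ → refl) xs ⟩
      wedge (λ y → ∑ {suc p} λ i → f p (toℕ i) * ε (toℕ i) y) χ xs
        ≈⟨ wedge-∑ˡ {suc p} (λ i y → f p (toℕ i) * ε (toℕ i) y) χ xs ⟩
      ∑ {suc p} (λ i → wedge (λ y → f p (toℕ i) * ε (toℕ i) y) χ xs)
        ≈⟨ ∑-cong (suc p) (λ i → trans (wedge-*ˡ (f p (toℕ i)) (ε (toℕ i)) χ xs) (single i)) ⟩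
      ∑ {suc p} (λ i → ε p (toℕ i) * (f p (toℕ i) * wedge (ε (toℕ i)) χ xs))
        ≈⟨ ∑-ε-< (λ x → f p x * wedge (ε x) χ xs) ℕ.≤-refl ⟩
      f p p * wedge (ε p) χ xs
        ≈⟨ trans (*-congʳ (diagonal p)) (*-identityˡ _) ⟩
      wedge (ε p) χ xs ∎
      where
      single : ∀ (i : Fin (suc p)) → f p (toℕ i) * wedge (ε (toℕ i)) χ xs ≈
        ε p (toℕ i) * (f p (toℕ i) * wedge (ε (toℕ i)) χ xs)
      single i with ℕ.m≤n⇒m<n∨m≡n (ℕ.≤-pred (toℕ<n i))
      ... | inj₂ i≡p = sym (trans (*-congʳ (trans (reflexive (≡.cong (ε p) i≡p)) (ε-same p))) (*-identityˡ _))
      ... | inj₁ i<p = trans zero′ (sym (trans (*-congˡ zero′) (zeroʳ _)))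
        where
        zero′ : f p (toℕ i) * wedge (ε (toℕ i)) χ xs ≈ 0#
        zero′ = trans (*-congˡ (kill i<p xs)) (zeroʳ _)

    wedges-downFrom : ∀ n φ xs → wedges f (downFrom n) φ xs ≈ wedges ε (downFrom n) φ xs
    wedges-downFrom zero    φ xs = refl
    wedges-downFrom (suc n) φ xs = trans
      (wedge-congʳ (wedges-downFrom n φ) xs)
      (wedge-leading n (wedge-repeated n φ) xs)

    -- In an increasing list the lower terms of a factor do not recur further right, so `χ` has to
    -- annihilate them. Once replaced, the first factor is moved into `χ`, which then annihilates
    -- everything below the next position; moving it back undoes the sign.
    wedges-upFrom : ∀ v m χ → (∀ j → v (suc j) ≡ suc (v j)) →
      (∀ {x} → x ℕ.< v 0 → ∀ xs → wedge (ε x) χ xs ≈ 0#) →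
      ∀ xs → wedges f (applyUpTo v m) χ xs ≈ wedges ε (applyUpTo v m) χ xs
    wedges-upFrom v zero    χ step kill xs = refl
    wedges-upFrom v (suc m) χ step kill xs = begin
      wedge (f (v 0)) (wedges f vs χ) xs
        ≈⟨ wedge-leading (v 0) (λ {x} x<v ys → trans (wedges-swap f vs (ε x) χ ys)
             (trans (*-congˡ (wedges-zero f vs (kill x<v) ys)) (zeroʳ _))) xs ⟩
      wedge (ε (v 0)) (wedges f vs χ) xs
        ≈⟨ wedges-swap f vs (ε (v 0)) χ xs ⟩
      sgn (length vs) * wedges f vs (wedge (ε (v 0)) χ) xs
        ≈⟨ *-congˡ (wedges-upFrom (v ∘ suc) m (wedge (ε (v 0)) χ) (step ∘ suc) kill′ xs) ⟩
      sgn (length vs) * wedges ε vs (wedge (ε (v 0)) χ) xs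
        ≈⟨ wedges-swap ε vs (ε (v 0)) χ xs ⟨
      wedge (ε (v 0)) (wedges ε vs χ) xs ∎
      where
      vs = applyUpTo (v ∘ suc) m
      wedges-zero : ∀ g ps {φ} → (∀ xs → φ xs ≈ 0#) → ∀ xs → wedges g ps φ xs ≈ 0#
      wedges-zero g []       p = p
      wedges-zero g (q ∷ ps) p = wedge-zeroʳ (g q) (wedges-zero g ps p)
      kill′ : ∀ {x} → x ℕ.< v 1 → ∀ xs → wedge (ε x) (wedge (ε (v 0)) χ) xs ≈ 0#
      kill′ {x} x<v₁ ys with ℕ.m≤n⇒m<n∨m≡n (ℕ.≤-pred (≡.subst (x ℕ.<_) (step 0) x<v₁))
      ... | inj₂ ≡.refl = wedge-self (ε x) χ ys
      ... | inj₁ x<v    = trans (wedge-anticomm (ε x) (ε (v 0)) χ ys)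
        (trans (-‿cong (wedge-zeroʳ (ε (v 0)) (kill x<v) ys)) -0#≈0#)

  wedge-twist : ∀ v φ xs →
    wedge (λ x → sgn x * v x) (λ ys → sgn (sum ys) * φ ys) xs ≈ sgn (sum xs) * wedge v φ xs
  wedge-twist v φ []       = sym (zeroʳ _)
  wedge-twist v φ (x ∷ xs) = begin
    (sgn x * v x) * (sgn (sum xs) * φ xs) -
      wedge v± (λ ys → sgn (x ℕ.+ sum ys) * φ (x ∷ ys)) xs
      ≈⟨ +-cong (*-interchange _ _ _ _) (-‿cong (trans
           (wedge-congʳ (λ ys → trans (*-congʳ (sgn-+ x (sum ys))) (*-assoc _ _ _)) xs)
           (trans (wedge-*ʳ v± (sgn x) _ xs) (*-congˡ (wedge-twist v (φ ∘ (x ∷_)) xs))))) ⟩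
    (sgn x * sgn (sum xs)) * (v x * φ xs) - sgn x * (sgn (sum xs) * wedge v (φ ∘ (x ∷_)) xs)
      ≈⟨ +-congˡ (-‿cong (sym (*-assoc _ _ _))) ⟩
    (sgn x * sgn (sum xs)) * (v x * φ xs) - (sgn x * sgn (sum xs)) * wedge v (φ ∘ (x ∷_)) xs
      ≈⟨ *-distribˡ-sub _ _ _ ⟨
    (sgn x * sgn (sum xs)) * wedge v φ (x ∷ xs)
      ≈⟨ *-congʳ (sgn-+ x (sum xs)) ⟨
    sgn (x ℕ.+ sum xs) * wedge v φ (x ∷ xs) ∎
    where
    v± : Vector
    v± x = sgn x * v x

  -- Scaling rows and columns by (-1)^position multiplies every term of the minor by the same sign.
  wedges-twist : ∀ f g → (∀ u x → g u x ≈ sgn (u ℕ.+ x) * f u x) → ∀ us xs →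
    wedges g us vac xs ≈ sgn (sum us ℕ.+ sum xs) * wedges f us vac xs
  wedges-twist f g p []       []       = sym (*-identityˡ _)
  wedges-twist f g p []       (x ∷ xs) = sym (zeroʳ _)
  wedges-twist f g p (u ∷ us) xs = begin
    wedge (g u) (wedges g us vac) xs
      ≈⟨ wedge-cong (λ x → trans (p u x) (trans (*-congʳ (sgn-+ u x)) (*-assoc _ _ _)))
           (λ ys → trans (wedges-twist f g p us ys)
             (trans (*-congʳ (sgn-+ (sum us) (sum ys))) (*-assoc _ _ _))) xs ⟩
    wedge (λ x → sgn u * (sgn x * f u x)) (λ ys → sgn (sum us) * (sgn (sum ys) * wedges f us vac ys)) xs
      ≈⟨ trans (wedge-*ˡ (sgn u) (λ x → sgn x * f u x) _ xs) (*-congˡ (wedge-*ʳ _ (sgn (sum us)) _ xs)) ⟩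
    sgn u * (sgn (sum us) * wedge (λ x → sgn x * f u x) (λ ys → sgn (sum ys) * wedges f us vac ys) xs)
      ≈⟨ *-congˡ (*-congˡ (wedge-twist (f u) (wedges f us vac) xs)) ⟩
    sgn u * (sgn (sum us) * (sgn (sum xs) * W))
      ≈⟨ *-assoc _ _ _ ⟨
    (sgn u * sgn (sum us)) * (sgn (sum xs) * W)
      ≈⟨ *-assoc _ _ _ ⟨
    ((sgn u * sgn (sum us)) * sgn (sum xs)) * W
      ≈⟨ *-congʳ (trans (sgn-+ (u ℕ.+ sum us) (sum xs)) (*-congʳ (sgn-+ u (sum us)))) ⟨
    sgn ((u ℕ.+ sum us) ℕ.+ sum xs) * W ∎
    where W = wedges f (u ∷ us) vac xs

-- Jacobi's identity for complementary minors.

module ComplementaryMinors {c ℓ} (R : CommutativeRing c ℓ) where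
  open CommutativeRing R hiding (zero)
  open Determinant rawRing using (det)
  open SetoidReasoning setoid
  open Forms R
  open Contractions R
  open Triangular R
  open Shuffle R

  module _ {r cl : ℕ → ℕ} {N M : ℕ} (conj : Conjugate r cl N M) where
    open Conjugate conj
    open Boundary conj

    -- Jacobi's theorem: f and g are inverse triangular matrices, and the rows
    -- N + r i - (i + 1) of the one are complementary to the columns N + j - cl j of the other.
    complementary-minors : ∀ (f g g± : ℕ → Vector) →
      (∀ {p x} → p ℕ.< x → f p x ≈ 0#) → (∀ p → f p p ≈ 1#) →
      (∀ {p u} → p ℕ.< N ℕ.+ M → u ℕ.< N ℕ.+ M → pairing (N ℕ.+ M) (f p) (g u) ≈ ε p u) →
      (∀ u x → g u x ≈ sgn (u ℕ.+ x) * g± u x) →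
      det {N} (λ i j → f ((N ℕ.+ r (toℕ i)) ℕ.∸ suc (toℕ i)) (N ℕ.∸ suc (toℕ j))) ≈
      det {M} (λ i j → g± ((N ℕ.+ toℕ i) ℕ.∸ cl (toℕ i)) (N ℕ.+ toℕ j))
    complementary-minors f g g± upper diagonal inverse twist = begin
      det {N} (λ i j → f ((N ℕ.+ r (toℕ i)) ℕ.∸ suc (toℕ i)) (N ℕ.∸ suc (toℕ j)))
        ≈⟨ det-wedges N f (λ i → (N ℕ.+ r i) ℕ.∸ suc i) (λ j → N ℕ.∸ suc j) ⟩
      wedges f (applyUpTo (λ i → (N ℕ.+ r i) ℕ.∸ suc i) N) vac (applyUpTo (λ j → N ℕ.∸ suc j) N)
        ≈⟨ reflexive (≡.cong₂ (λ ps xs → wedges f ps vac xs)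
             (applyUpTo-cong N λ {i} _ → ≡.cong (λ t → (N ℕ.+ t) ℕ.∸ suc i) (≡.sym (ℕ.m≤n⇒m⊓n≡m (r≤M i))))
             (applyUpTo-downFrom N)) ⟩
      wedges f ps vac A
        ≈⟨ contracts-dual n inverse us ps positions-unique positions-< A ⟨
      contracts n g us (wedges f (us ++ ps) vac) A
        ≈⟨ reflexive (≡.cong (λ φ → contracts n g us φ A) (wedges-++ f us ps vac)) ⟩
      contracts n g us (wedges f us (wedges f ps vac)) A
        ≈⟨ contracts-cong n g us (wedges-shuffle conj f M vac) A ⟩
      contracts n g us (λ xs → sgn s * wedges f vs (wedges f (applyUpTo (rowPos 0) N) vac) xs) A
        ≈⟨ contracts-* n g us (sgn s) _ A ⟩
      sgn s * contracts n g us (wedges f vs (wedges f (applyUpTo (rowPos 0) N) vac)) A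
        ≈⟨ *-congˡ (reflexive (≡.cong (λ l → contracts n g us (wedges f vs (wedges f l vac)) A) initial)) ⟩
      sgn s * contracts n g us (wedges f vs (wedges f (downFrom N) vac)) A
        -- The sorted positions are exactly those below `N + M`, where unitriangularity allows `f`
        -- to be replaced by the coordinate covectors.
        ≈⟨ *-congˡ (contracts-cong n g us leading A) ⟩
      sgn s * contracts n g us (wedges ε vs χ) A
        -- The arguments `A` are the positions below `N`, hence disjoint from `vs`: the contractions
        -- use up all factors from `N` upwards and leave `χ A`.
        ≈⟨ *-congˡ (contracts-wedges-ε n g A us vs χ lengths vs∉A) ⟩
      sgn s * (wedges g us vac vs * χ A)
        ≈⟨ *-congˡ (trans (*-congˡ (wedges-ε-same A (Unique.downFrom⁺ N))) (*-identityʳ _)) ⟩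
      sgn s * wedges g us vac vs
        ≈⟨ *-congˡ (wedges-twist g± g twist us vs) ⟩
      sgn s * (sgn (sum us ℕ.+ sum vs) * wedges g± us vac vs)
        ≈⟨ *-assoc _ _ _ ⟨
      (sgn s * sgn (sum us ℕ.+ sum vs)) * wedges g± us vac vs
        ≈⟨ *-congʳ even ⟩
      1# * wedges g± us vac vs
        ≈⟨ *-identityˡ _ ⟩
      wedges g± us vac vs
        ≈⟨ det-wedges M g± colPos (N ℕ.+_) ⟨
      det {M} (λ i j → g± (colPos (toℕ i)) (N ℕ.+ toℕ j)) ∎
      where
      n = N ℕ.+ M
      s = sum (applyUpTo cl M)
      us = applyUpTo colPos M
      ps = applyUpTo (rowPos M) N
      vs = applyUpTo (N ℕ.+_) M
      A = downFrom N
      χ : Form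
      χ = wedges ε A vac
      initial : applyUpTo (rowPos 0) N ≡ downFrom N
      initial = ≡.trans
        (applyUpTo-cong N λ {i} _ → ≡.cong (ℕ._∸ suc i)
          (≡.trans (≡.cong (N ℕ.+_) (ℕ.⊓-zeroʳ (r i))) (ℕ.+-identityʳ N)))
        (applyUpTo-downFrom N)
      leading : ∀ xs → wedges f vs (wedges f A vac) xs ≈ wedges ε vs χ xs
      leading xs = trans
        (wedges-cong f vs (wedges-downFrom upper diagonal N vac) xs)
        (wedges-upFrom upper diagonal (N ℕ.+_) M χ (ℕ.+-suc N)
          (λ {x} x<N → wedge-repeated N vac (≡.subst (x ℕ.<_) (ℕ.+-identityʳ N) x<N)) xs)
      lengths : length us ℕ.≤ length vs
      lengths = ℕ.≤-reflexive (≡.trans (length-applyUpTo colPos M) (≡.sym (length-applyUpTo (N ℕ.+_) M)))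
      vs∉A : All (λ v → v ℕ.< n × All (v ≢_) A) vs
      vs∉A = All.applyUpTo⁺₁ (N ℕ.+_) M λ {j} j<M → ℕ.+-monoʳ-< N j<M ,
        All.tabulate λ x∈A eq → ℕ.<⇒≱ (∈-downFrom⁻ x∈A) (≡.subst (N ℕ.≤_) eq (ℕ.m≤m+n N j))
      -- Summing `colPos j + cl j = N + j` over the columns turns the total exponent into twice
      -- `sum vs`.
      even : sgn s * sgn (sum us ℕ.+ sum vs) ≈ 1#
      even = begin
        sgn s * sgn (sum us ℕ.+ sum vs)   ≈⟨ sgn-+ s _ ⟨
        sgn (s ℕ.+ (sum us ℕ.+ sum vs))   ≈⟨ reflexive (≡.cong sgn (≡.trans
          (≡.sym (ℕ.+-assoc s (sum us) (sum vs)))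
          (≡.cong (ℕ._+ sum vs) (≡.trans (ℕ.+-comm s (sum us)) (sum-applyUpTo-+ M colPos+))))) ⟩
        sgn (sum vs ℕ.+ sum vs)           ≈⟨ sgn-double (sum vs) ⟩
        1#                                ∎

-- Triangular matrices built from a power series and a parameter sequence.

module FactorialMatrix {c ℓ} (R : CommutativeRing c ℓ) where
  open CommutativeRing R hiding (zero)
  open RingProperties ring
  open CommutativeSemigroupProperties
    (CommutativeMonoid.commutativeSemigroup +-commutativeMonoid) using (interchange)
  open CommutativeSemigroupProperties
    (CommutativeMonoid.commutativeSemigroup *-commutativeMonoid) using ()
    renaming (x∙yz≈y∙xz to x*yz≈y*xz)
  open SemiringSum semiring using (∑-distrib-+; *-distribˡ-sum)
  open SetoidReasoning setoid
  open Forms R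
  open Contractions R
  open Antidiagonal R
  open ComplementaryMinors R
  open Determinant rawRing using (det)

  Sequence : Set c
  Sequence = ℕ → Carrier

  infixl 7 _⋆_

  _⋆_ : Sequence → Sequence → Sequence
  (A ⋆ B) k = ▵ k λ i j → A i * B j

  one : Sequence
  one zero    = 1#
  one (suc _) = 0#

  module _ (b : ℕ → Carrier) where

    -- F A p q is the coefficient of t^(p - q) in (∑ A k tᵏ) ∏ (1 - b x t), the product
    -- being over q < x < p; in particular F A p p = A 0.
    F : Sequence → ℕ → Vector
    F A zero    q = A 0 * ε 0 q
    F A (suc p) q = A 0 * (ε (suc p) q + b p * ε p q) + (F (A ∘ suc) p q - b p * F A p q)

    F-cong : ∀ {A B} → (∀ k → A k ≈ B k) → ∀ p q → F A p q ≈ F B p q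
    F-cong eq zero    q = *-congʳ (eq 0)
    F-cong eq (suc p) q = +-cong (*-congʳ (eq 0))
      (+-cong (F-cong (eq ∘ suc) p q) (-‿cong (*-congˡ (F-cong eq p q))))

    F-* : ∀ a A p q → F (λ k → a * A k) p q ≈ a * F A p q
    F-* a A zero    q = *-assoc _ _ _
    F-* a A (suc p) q = begin
      (a * A 0) * E + (F (λ k → a * A (suc k)) p q - b p * F (λ k → a * A k) p q)
        ≈⟨ +-cong (*-assoc _ _ _) (+-cong (F-* a (A ∘ suc) p q)
             (-‿cong (trans (*-congˡ (F-* a A p q)) (x*yz≈y*xz _ _ _)))) ⟩
      a * (A 0 * E) + (a * F (A ∘ suc) p q - a * (b p * F A p q))
        ≈⟨ +-congˡ (*-distribˡ-sub _ _ _) ⟨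
      a * (A 0 * E) + a * (F (A ∘ suc) p q - b p * F A p q)
        ≈⟨ distribˡ _ _ _ ⟨
      a * F A (suc p) q ∎
      where E = ε (suc p) q + b p * ε p q

    F-+ : ∀ A B p q → F (λ k → A k + B k) p q ≈ F A p q + F B p q
    F-+ A B zero    q = distribʳ _ _ _
    F-+ A B (suc p) q = begin
      (A 0 + B 0) * E + (F (λ k → A (suc k) + B (suc k)) p q - b p * F (λ k → A k + B k) p q)
        ≈⟨ +-cong (distribʳ _ _ _) (+-cong (F-+ (A ∘ suc) (B ∘ suc) p q)
             (-‿cong (trans (*-congˡ (F-+ A B p q)) (distribˡ _ _ _)))) ⟩
      (A 0 * E + B 0 * E) +
        ((F (A ∘ suc) p q + F (B ∘ suc) p q) - (b p * F A p q + b p * F B p q))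
        ≈⟨ +-congˡ (sub-interchange _ _ _ _) ⟩
      (A 0 * E + B 0 * E) +
        ((F (A ∘ suc) p q - b p * F A p q) + (F (B ∘ suc) p q - b p * F B p q))
        ≈⟨ interchange _ _ _ _ ⟩
      F A (suc p) q + F B (suc p) q ∎
      where E = ε (suc p) q + b p * ε p q

    F-zero : ∀ {A} → (∀ k → A k ≈ 0#) → ∀ p q → F A p q ≈ 0#
    F-zero {A} A≈0 p q = trans
      (F-cong (λ k → trans (A≈0 k) (sym (zeroˡ 0#))) p q)
      (trans (F-* 0# (λ _ → 0#) p q) (zeroˡ _))

    F-one : ∀ {A} → (∀ k → A k ≈ one k) → ∀ p q → F A p q ≈ ε p q
    F-one A≈ zero    q = trans (*-congʳ (A≈ 0)) (*-identityˡ _)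
    F-one {A} A≈ (suc p) q = begin
      A 0 * (ε (suc p) q + b p * ε p q) + (F (A ∘ suc) p q - b p * F A p q)
        ≈⟨ +-cong (trans (*-congʳ (A≈ 0)) (*-identityˡ _))
             (+-cong (F-zero (A≈ ∘ suc) p q) (-‿cong (*-congˡ (F-one A≈ p q)))) ⟩
      (ε (suc p) q + b p * ε p q) + (0# - b p * ε p q)
        ≈⟨ trans (+-congˡ (+-identityˡ _)) (+-assoc _ _ _) ⟩
      ε (suc p) q + (b p * ε p q - b p * ε p q)
        ≈⟨ trans (+-congˡ (-‿inverseʳ _)) (+-identityʳ _) ⟩
      ε (suc p) q ∎

    F-upper : ∀ A {p q} → p ℕ.< q → F A p q ≈ 0#
    F-upper A {zero}  p<q = trans (*-congˡ (ε-diff (ℕ.<⇒≢ p<q))) (zeroʳ _)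
    F-upper A {suc p} {q} p<q = begin
      A 0 * (ε (suc p) q + b p * ε p q) + (F (A ∘ suc) p q - b p * F A p q)
        ≈⟨ +-cong
             (*-congˡ (+-cong (ε-diff (ℕ.<⇒≢ p<q)) (trans (*-congˡ (ε-diff (ℕ.<⇒≢ p<q′))) (zeroʳ _))))
             (+-cong (F-upper (A ∘ suc) p<q′) (-‿cong (trans (*-congˡ (F-upper A p<q′)) (zeroʳ _)))) ⟩
      A 0 * (0# + 0#) + (0# - 0#)
        ≈⟨ +-cong (trans (*-congˡ (+-identityˡ 0#)) (zeroʳ _)) (-‿inverseʳ 0#) ⟩
      0# + 0#
        ≈⟨ +-identityˡ 0# ⟩
      0# ∎
      where p<q′ = ℕ.<-trans (ℕ.n<1+n p) p<q

    F-diagonal : ∀ A p → F A p p ≈ A 0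
    F-diagonal A zero    = *-identityʳ _
    F-diagonal A (suc p) = begin
      A 0 * (ε p p + b p * ε p (suc p)) + (F (A ∘ suc) p (suc p) - b p * F A p (suc p))
        ≈⟨ +-cong
             (*-congˡ (+-cong (ε-same p) (trans (*-congˡ (ε-diff (ℕ.<⇒≢ (ℕ.n<1+n p)))) (zeroʳ _))))
             (+-cong (F-upper (A ∘ suc) (ℕ.n<1+n p)) (-‿cong (trans (*-congˡ (F-upper A (ℕ.n<1+n p))) (zeroʳ _)))) ⟩
      A 0 * (1# + 0#) + (0# - 0#)
        ≈⟨ +-cong (trans (*-congˡ (+-identityʳ 1#)) (*-identityʳ _)) (-‿inverseʳ 0#) ⟩
      A 0 + 0#
        ≈⟨ +-identityʳ _ ⟩
      A 0 ∎

    module _ (n : ℕ) where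

      pairing-+ : ∀ v w g → pairing n (λ x → v x + w x) g ≈ pairing n v g + pairing n w g
      pairing-+ v w g = trans
        (∑-cong n λ i → distribʳ (g (toℕ i)) (v (toℕ i)) (w (toℕ i)))
        (∑-distrib-+ {n} (λ i → v (toℕ i) * g (toℕ i)) (λ i → w (toℕ i) * g (toℕ i)))

      pairing-* : ∀ a v g → pairing n (λ x → a * v x) g ≈ a * pairing n v g
      pairing-* a v g = trans
        (∑-cong n λ i → *-assoc a (v (toℕ i)) (g (toℕ i)))
        (sym (*-distribˡ-sum {n} a (λ i → v (toℕ i) * g (toℕ i))))

      pairing-neg : ∀ v g → pairing n (λ x → - v x) g ≈ - pairing n v g
      pairing-neg v g = trans
        (∑-cong n λ i → sym (-‿distribˡ-* (v (toℕ i)) (g (toℕ i))))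
        (∑-neg {n} (λ i → v (toℕ i) * g (toℕ i)))

      -- Induction on the row. The part of row p + 1 with coefficient `A 0` picks out
      -- `F B (suc p) q + b p * F B p q`, in which the subtracted term of the recursion for `F B`
      -- cancels. What is left is the recursion for `A ⋆ B`, whose shift is `A 0` times the shift of
      -- `B` plus the shift of `A` times `B`; `F` is linear in its series.
      F-⋆ : ∀ A B {p} q → p ℕ.< n → pairing n (F A p) (λ x → F B x q) ≈ F (A ⋆ B) p q
      F-⋆ A B {zero} q p<n = begin
        pairing n (λ x → A 0 * ε 0 x) G ≈⟨ pairing-* (A 0) (ε 0) G ⟩
        A 0 * pairing n (ε 0) G         ≈⟨ *-congˡ (∑-ε-< G p<n) ⟩
        A 0 * (B 0 * ε 0 q)             ≈⟨ *-assoc _ _ _ ⟨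
        (A 0 * B 0) * ε 0 q             ∎
        where
        G : Vector
        G x = F B x q
      F-⋆ A B {suc p} q p<n = begin
        pairing n (λ x → A 0 * (ε (suc p) x + b p * ε p x) + (F A′ p x - b p * F A p x)) G
          ≈⟨ pairing-+ (λ x → A 0 * (ε (suc p) x + b p * ε p x)) (λ x → F A′ p x - b p * F A p x) G ⟩
        pairing n (λ x → A 0 * (ε (suc p) x + b p * ε p x)) G + pairing n (λ x → F A′ p x - b p * F A p x) G
          ≈⟨ +-cong
               (trans (pairing-* (A 0) (λ x → ε (suc p) x + b p * ε p x) G) (*-congˡ
                 (trans (pairing-+ (ε (suc p)) (λ x → b p * ε p x) G)
                   (+-cong (∑-ε-< G p<n) (trans (pairing-* (b p) (ε p) G) (*-congˡ (∑-ε-< G p<n′)))))))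
               (trans (pairing-+ (F A′ p) (λ x → - (b p * F A p x)) G)
                 (+-cong (F-⋆ A′ B q p<n′) (trans (pairing-neg (λ x → b p * F A p x) G)
                   (-‿cong (trans (pairing-* (b p) (F A p) G) (*-congˡ (F-⋆ A B q p<n′))))))) ⟩
        A 0 * ((B 0 * E + (F B′ p q - b p * F B p q)) + b p * F B p q) + (F (A′ ⋆ B) p q - b p * F (A ⋆ B) p q)
          ≈⟨ +-congʳ (*-congˡ (trans (+-assoc _ _ _) (+-congˡ (trans (+-assoc _ _ _)
               (trans (+-congˡ (-‿inverseˡ _)) (+-identityʳ _)))))) ⟩
        A 0 * (B 0 * E + F B′ p q) + (F (A′ ⋆ B) p q - b p * F (A ⋆ B) p q)
          ≈⟨ +-congʳ (trans (distribˡ _ _ _) (+-congʳ (sym (*-assoc _ _ _)))) ⟩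
        ((A 0 * B 0) * E + A 0 * F B′ p q) + (F (A′ ⋆ B) p q - b p * F (A ⋆ B) p q)
          ≈⟨ trans (+-assoc _ _ _) (+-congˡ (sym (+-assoc _ _ _))) ⟩
        (A 0 * B 0) * E + ((A 0 * F B′ p q + F (A′ ⋆ B) p q) - b p * F (A ⋆ B) p q)
          ≈⟨ +-congˡ (+-congʳ (trans (F-+ (λ k → A 0 * B′ k) (A′ ⋆ B) p q) (+-congʳ (F-* (A 0) B′ p q)))) ⟨
        F (A ⋆ B) (suc p) q ∎
        where
        G : Vector
        G x = F B x q
        A′ B′ : Sequence
        A′ = A ∘ suc
        B′ = B ∘ suc
        E = ε (suc p) q + b p * ε p q
        p<n′ = ℕ.<-trans (ℕ.n<1+n p) p<n

  -- C β m d is the coefficient of tᵈ in ∏ (1 - β i t) over i < m.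
  C : (ℕ → Carrier) → ℕ → ℕ → Carrier
  C β m       zero    = 1#
  C β zero    (suc d) = 0#
  C β (suc m) (suc d) = C β m (suc d) - β m * C β m d

  C-degree : ∀ β {m d} → m ℕ.< d → C β m d ≈ 0#
  C-degree β {zero}  {suc d} _         = refl
  C-degree β {suc m} {suc d} (s<s m<d) = trans
    (+-cong (C-degree β (ℕ.m<n⇒m<1+n m<d)) (-‿cong (trans (*-congˡ (C-degree β m<d)) (zeroʳ _))))
    (-‿inverseʳ 0#)

  -- The product has `m` factors and the degree read off is m + 1, so the series always contributes
  -- at least degree 1; hence `A (suc i)`.
  F-C : ∀ b A m q → F b A (suc (m ℕ.+ q)) q ≈ ▵ m λ i d → C (λ x → b (suc (x ℕ.+ q))) m d * A (suc i)
  F-C b A zero q = begin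
    A 0 * (ε (suc q) q + b q * ε q q) + (F b (A ∘ suc) q q - b q * F b A q q)
      ≈⟨ +-cong
           (*-congˡ (+-cong (ε-diff (ℕ.<⇒≢ (ℕ.n<1+n q) ∘ ≡.sym)) (trans (*-congˡ (ε-same q)) (*-identityʳ _))))
           (+-cong (F-diagonal b (A ∘ suc) q) (-‿cong (*-congˡ (F-diagonal b A q)))) ⟩
    A 0 * (0# + b q) + (A 1 - b q * A 0)
      ≈⟨ +-cong (trans (*-congˡ (+-identityˡ _)) (*-comm _ _)) (+-comm _ _) ⟩
    b q * A 0 + (- (b q * A 0) + A 1)
      ≈⟨ trans (sym (+-assoc _ _ _)) (trans (+-congʳ (-‿inverseʳ _)) (+-identityˡ _)) ⟩
    A 1
      ≈⟨ *-identityˡ _ ⟨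
    1# * A 1 ∎
  F-C b A (suc m) q = begin
    A 0 * (ε (suc p) q + b p * ε p q) + (F b (A ∘ suc) p q - b p * F b A p q)
      ≈⟨ +-cong
           (trans (*-congˡ (+-cong (ε-diff (≢q (suc m))) (trans (*-congˡ (ε-diff (≢q m))) (zeroʳ _))))
             (trans (*-congˡ (+-identityˡ 0#)) (zeroʳ _)))
           (+-cong (F-C b (A ∘ suc) m q) (-‿cong (*-congˡ (F-C b A m q)))) ⟩
    0# + (▵ m (λ i d → C β m d * A (suc (suc i))) - b p * S)
      -- Prepends the term with `C β m (suc m)`, which is zero by degree; the full antidiagonal can
      -- then be split at its other end.
      ≈⟨ +-congˡ (+-congʳ (sym (trans
           (+-congʳ (trans (*-congʳ (C-degree β (ℕ.n<1+n m))) (zeroˡ _))) (+-identityˡ _)))) ⟩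
    0# + (▵ (suc m) (λ i d → C β m d * A (suc i)) - b p * S)
      ≈⟨ +-identityˡ _ ⟩
    ▵ (suc m) (λ i d → C β m d * A (suc i)) - b p * S
      ≈⟨ +-congʳ (▵-last m (λ i d → C β m d * A (suc i))) ⟩
    (T + 1# * A (suc (suc m))) - b p * S
      ≈⟨ trans (+-assoc _ _ _) (trans (+-congˡ (+-comm _ _)) (sym (+-assoc _ _ _))) ⟩
    (T - b p * S) + 1# * A (suc (suc m))
      ≈⟨ +-congʳ (+-congˡ (trans (-‿distribˡ-* _ _) (▵-*ˡ m (- b p) (λ i d → C β m d * A (suc i))))) ⟩
    (T + ▵ m (λ i d → - b p * (C β m d * A (suc i)))) + 1# * A (suc (suc m))
      ≈⟨ +-congʳ (▵-+ m (λ i d → C β m (suc d) * A (suc i)) (λ i d → - b p * (C β m d * A (suc i)))) ⟨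
    ▵ m (λ i d → C β m (suc d) * A (suc i) + - b p * (C β m d * A (suc i))) + 1# * A (suc (suc m))
      ≈⟨ +-congʳ (▵-cong′ m λ i d → trans (distribʳ _ _ _) (+-congˡ
           (trans (*-congʳ (-‿distribˡ-* _ _)) (*-assoc _ _ _)))) ⟨
    ▵ m (λ i d → C β (suc m) (suc d) * A (suc i)) + 1# * A (suc (suc m))
      ≈⟨ ▵-last m (λ i d → C β (suc m) d * A (suc i)) ⟨
    ▵ (suc m) (λ i d → C β (suc m) d * A (suc i)) ∎
    where
    p = suc (m ℕ.+ q)
    β : ℕ → Carrier
    β x = b (suc (x ℕ.+ q))
    S = ▵ m λ i d → C β m d * A (suc i)
    T = ▵ m λ i d → C β m (suc d) * A (suc i)
    ≢q : ∀ k → suc (k ℕ.+ q) ≢ q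
    ≢q k eq = ℕ.<-irrefl ≡.refl (≡.subst (q ℕ.<_) eq (s≤s (ℕ.m≤n+m q k)))

  module _ {r cl : ℕ → ℕ} {N M : ℕ} (conj : Conjugate r cl N M) where

    -- Since `F` is multiplicative and sends `one` to the identity, `B` supplies the inverse matrix.
    -- It enters transposed, as the dual basis, with its checkerboard sign split off.
    complementary-minors-F : ∀ b A B → (∀ k → (A ⋆ B) k ≈ one k) → A 0 ≈ 1# →
      det {N} (λ i j → F b A ((N ℕ.+ r (toℕ i)) ℕ.∸ suc (toℕ i)) (N ℕ.∸ suc (toℕ j))) ≈
      det {M} (λ i j → let u = (N ℕ.+ toℕ i) ℕ.∸ cl (toℕ i) ; v = N ℕ.+ toℕ j in
        sgn (u ℕ.+ v) * F b B v u)
    complementary-minors-F b A B A⋆B≈one A₀≈1 = complementary-minors conj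
      (F b A) (λ u v → F b B v u) (λ u v → sgn (u ℕ.+ v) * F b B v u)
      (F-upper b A) (λ p → trans (F-diagonal b A p) A₀≈1)
      (λ {p} {u} p<n _ → trans (F-⋆ b (N ℕ.+ M) A B u p<n) (F-one b A⋆B≈one p u))
      (λ u v → sym (sgn-cancel (u ℕ.+ v) _))

-- The ring of symmetric functions, and the relation between `e` and `h`.

module SymmetricFunctionRing {c r} (K : CommutativeRing c r) where
  open CommutativeRing K hiding (zero)
  open SymmetricFunctions K
  open Antidiagonal K
  open Forms K using (sgn; sgn-suc-*)
  open SetoidReasoning setoid

  cauchy-▵ : ∀ f g n α → cauchy f g (n ∷ α) ≈ ▵ n λ i j → cauchy (slice f i) (slice g j) α
  cauchy-▵ f g n α = ∑-▵ n λ i j → cauchy (slice f i) (slice g j) α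

  cauchy-+ˡ : ∀ f f′ g α → cauchy (λ β → f β + f′ β) g α ≈ cauchy f g α + cauchy f′ g α
  cauchy-+ˡ f f′ g []      = distribʳ _ _ _
  cauchy-+ˡ f f′ g (n ∷ α) = begin
    cauchy (λ β → f β + f′ β) g (n ∷ α)
      ≈⟨ cauchy-▵ (λ β → f β + f′ β) g n α ⟩
    ▵ n (λ i j → cauchy (λ β → f (i ∷ β) + f′ (i ∷ β)) (slice g j) α)
      ≈⟨ ▵-cong′ n (λ i j → cauchy-+ˡ (slice f i) (slice f′ i) (slice g j) α) ⟩
    ▵ n (λ i j → cauchy (slice f i) (slice g j) α + cauchy (slice f′ i) (slice g j) α)
      ≈⟨ ▵-+ n (λ i j → cauchy (slice f i) (slice g j) α) (λ i j → cauchy (slice f′ i) (slice g j) α) ⟩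
    ▵ n (λ i j → cauchy (slice f i) (slice g j) α) + ▵ n (λ i j → cauchy (slice f′ i) (slice g j) α)
      ≈⟨ +-cong (cauchy-▵ f g n α) (cauchy-▵ f′ g n α) ⟨
    cauchy f g (n ∷ α) + cauchy f′ g (n ∷ α) ∎

  cauchy-*ˡ : ∀ x f g α → cauchy (λ β → x * f β) g α ≈ x * cauchy f g α
  cauchy-*ˡ x f g []      = *-assoc _ _ _
  cauchy-*ˡ x f g (n ∷ α) = begin
    cauchy (λ β → x * f β) g (n ∷ α)
      ≈⟨ cauchy-▵ (λ β → x * f β) g n α ⟩
    ▵ n (λ i j → cauchy (λ β → x * f (i ∷ β)) (slice g j) α)
      ≈⟨ ▵-cong′ n (λ i j → cauchy-*ˡ x (slice f i) (slice g j) α) ⟩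
    ▵ n (λ i j → x * cauchy (slice f i) (slice g j) α)
      ≈⟨ ▵-*ˡ n x (λ i j → cauchy (slice f i) (slice g j) α) ⟨
    x * ▵ n (λ i j → cauchy (slice f i) (slice g j) α)
      ≈⟨ *-congˡ (cauchy-▵ f g n α) ⟨
    x * cauchy f g (n ∷ α) ∎

  cauchy-comm : ∀ f g α → cauchy f g α ≈ cauchy g f α
  cauchy-comm f g []      = *-comm _ _
  cauchy-comm f g (n ∷ α) = begin
    cauchy f g (n ∷ α)
      ≈⟨ cauchy-▵ f g n α ⟩
    ▵ n (λ i j → cauchy (slice f i) (slice g j) α)
      ≈⟨ ▵-comm n (λ i j → cauchy (slice f i) (slice g j) α) ⟩
    ▵ n (λ j i → cauchy (slice f i) (slice g j) α)
      ≈⟨ ▵-cong′ n (λ j i → cauchy-comm (slice f i) (slice g j) α) ⟩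
    ▵ n (λ j i → cauchy (slice g j) (slice f i) α)
      ≈⟨ cauchy-▵ g f n α ⟨
    cauchy g f (n ∷ α) ∎

  cauchy-▵ˡ : ∀ n (f : ℕ → ℕ → Series) g α →
    cauchy (λ β → ▵ n λ i j → f i j β) g α ≈ ▵ n λ i j → cauchy (f i j) g α
  cauchy-▵ˡ zero    f g α = refl
  cauchy-▵ˡ (suc n) f g α = trans
    (cauchy-+ˡ (f 0 (suc n)) (λ β → ▵ n λ i j → f (suc i) j β) g α)
    (+-congˡ (cauchy-▵ˡ n (λ i → f (suc i)) g α))

  cauchy-▵ʳ : ∀ n f (g : ℕ → ℕ → Series) α →
    cauchy f (λ β → ▵ n λ i j → g i j β) α ≈ ▵ n λ i j → cauchy f (g i j) α
  cauchy-▵ʳ n f g α = trans (cauchy-comm f _ α) (trans (cauchy-▵ˡ n g f α)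
    (▵-cong′ n λ i j → cauchy-comm (g i j) f α))

  cauchy-assoc : ∀ f g k α → cauchy (cauchy f g) k α ≈ cauchy f (cauchy g k) α
  cauchy-assoc f g k []      = *-assoc _ _ _
  cauchy-assoc f g k (n ∷ α) = begin
    cauchy (cauchy f g) k (n ∷ α)
      ≈⟨ cauchy-▵ (cauchy f g) k n α ⟩
    ▵ n (λ m l → cauchy (slice (cauchy f g) m) (slice k l) α)
      ≈⟨ ▵-cong′ n (λ m l → trans (cauchy-cong (cauchy-▵ f g m) (λ _ → refl) α)
           (cauchy-▵ˡ m (λ i j → cauchy (slice f i) (slice g j)) (slice k l) α)) ⟩
    ▵ n (λ m l → ▵ m λ i j → cauchy (cauchy (slice f i) (slice g j)) (slice k l) α)
      ≈⟨ ▵-cong′ n (λ m l → ▵-cong′ m λ i j → cauchy-assoc (slice f i) (slice g j) (slice k l) α) ⟩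
    ▵ n (λ m l → ▵ m λ i j → cauchy (slice f i) (cauchy (slice g j) (slice k l)) α)
      ≈⟨ ▵-assoc n (λ i j l → cauchy (slice f i) (cauchy (slice g j) (slice k l)) α) ⟩
    ▵ n (λ i m → ▵ m λ j l → cauchy (slice f i) (cauchy (slice g j) (slice k l)) α)
      ≈⟨ ▵-cong′ n (λ i m → trans (cauchy-cong (λ _ → refl) (cauchy-▵ g k m) α)
           (cauchy-▵ʳ m (slice f i) (λ j l → cauchy (slice g j) (slice k l)) α)) ⟨
    ▵ n (λ i m → cauchy (slice f i) (slice (cauchy g k) m) α)
      ≈⟨ cauchy-▵ f (cauchy g k) n α ⟨
    cauchy f (cauchy g k) (n ∷ α) ∎

  cauchy-zeroˡ : ∀ {f} g → (∀ α → f α ≈ 0#) → ∀ α → cauchy f g α ≈ 0#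
  cauchy-zeroˡ {f} g p α = cauchy-vanish f g α λ β γ _ → trans (*-congʳ (p β)) (zeroˡ _)

  -- By computation the slice of `𝟙` at exponent 0 is `𝟙` again, and every other slice is zero.
  cauchy-identityˡ : ∀ f α → cauchy (coeff 𝟙) f α ≈ f α
  cauchy-identityˡ f []            = *-identityˡ _
  cauchy-identityˡ f (zero ∷ α)    = trans (+-identityʳ _) (cauchy-identityˡ (slice f 0) α)
  cauchy-identityˡ f (suc n ∷ α)   = begin
    cauchy (coeff 𝟙) f (suc n ∷ α)
      ≈⟨ cauchy-▵ (coeff 𝟙) f (suc n) α ⟩
    cauchy (coeff 𝟙) (slice f (suc n)) α + ▵ n (λ i j → cauchy (λ _ → 0#) (slice f j) α)
      ≈⟨ +-cong (cauchy-identityˡ (slice f (suc n)) α)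
           (▵-zero n λ i j _ → cauchy-zeroˡ (slice f j) (λ _ → refl) α) ⟩
    f (suc n ∷ α) + 0#
      ≈⟨ +-identityʳ _ ⟩
    f (suc n ∷ α) ∎

  Λ-isCommutativeRing : IsCommutativeRing _≋_ _⊕_ _⊗_ ⊖_ 𝟘 𝟙
  Λ-isCommutativeRing = record
    { isRing = record
      { +-isAbelianGroup = record
        { isGroup = record
          { isMonoid = record
            { isSemigroup = record
              { isMagma = record
                { isEquivalence = record
                  { refl  = λ α → refl
                  ; sym   = λ p α → sym (p α)
                  ; trans = λ p q α → trans (p α) (q α)
                  }
                ; ∙-cong = λ p q α → +-cong (p α) (q α)
                }
              ; assoc = λ f g k α → +-assoc _ _ _
              }
            ; identity = (λ f α → +-identityˡ _) , (λ f α → +-identityʳ _)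
            }
          ; inverse = (λ f α → -‿inverseˡ _) , (λ f α → -‿inverseʳ _)
          ; ⁻¹-cong = λ p α → -‿cong (p α)
          }
        ; comm = λ f g α → +-comm _ _
        }
      ; *-cong = λ p q → cauchy-cong p q
      ; *-assoc = λ f g k → cauchy-assoc (coeff f) (coeff g) (coeff k)
      ; *-identity = identityˡ , λ f α → trans (cauchy-comm (coeff f) (coeff 𝟙) α) (identityˡ f α)
      ; distrib = (λ f g k α → trans (cauchy-comm (coeff f) _ α) (trans (distribˡ′ f g k α)
                    (+-cong (cauchy-comm (coeff g) (coeff f) α) (cauchy-comm (coeff k) (coeff f) α))))
                , distribˡ′
      }
    ; *-comm = λ f g → cauchy-comm (coeff f) (coeff g)
    }
    where
    identityˡ : ∀ f → 𝟙 ⊗ f ≋ f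
    identityˡ f = cauchy-identityˡ (coeff f)
    distribˡ′ : ∀ f g k → (g ⊕ k) ⊗ f ≋ (g ⊗ f) ⊕ (k ⊗ f)
    distribˡ′ f g k = cauchy-+ˡ (coeff g) (coeff k) (coeff f)

  Λ-commutativeRing : CommutativeRing _ _
  Λ-commutativeRing = record { isCommutativeRing = Λ-isCommutativeRing }

  private module Λ▵ = Antidiagonal Λ-commutativeRing

  coeff-▵ : ∀ n f α → coeff (Λ▵.▵ n f) α ≡ ▵ n λ i j → coeff (f i j) α
  coeff-▵ zero    f α = ≡.refl
  coeff-▵ (suc n) f α = ≡.cong (λ x → coeff (f 0 (suc n)) α + x) (coeff-▵ n (λ i → f (suc i)) α)

  private
    E H : ℕ → Series
    E i = coeff (e i)
    H j = coeff (h j)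

  slice-e-≥2 : ∀ i n β → slice (E i) (suc (suc n)) β ≈ 0#
  slice-e-≥2 i n β = indicator-no (squarefree? i (suc (suc n) ∷ β))
    λ { (_ , s≤s () ∷ _) }

  -- x₁ contributes the factor (1 + x₁ t)/(1 + x₁ t) to E(t) H(-t), whose coefficient of x₁ⁿ⁺¹
  -- is a sum of two terms that cancel.
  e-h-orthogonal : ∀ k α → ▵ (suc k) (λ i j → sgn j * cauchy (E i) (H j) α) ≈ 0#
  e-h-orthogonal k [] = trans
    (+-cong (trans (*-congˡ (zeroʳ _)) (zeroʳ _))
      (▵-zero k λ i j _ → trans (*-congˡ (zeroˡ _)) (zeroʳ _)))
    (+-identityˡ 0#)
  e-h-orthogonal k (zero ∷ α) = trans
    (▵-cong′ (suc k) λ i j → *-congˡ {sgn j} (+-identityʳ (cauchy (E i) (H j) α))) (e-h-orthogonal k α)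
  e-h-orthogonal k (suc n ∷ α) = begin
    ▵ (suc k) (λ i j → sgn j * cauchy (E i) (H j) (suc n ∷ α))
      ≈⟨ ▵-cong′ (suc k) (λ i j → trans (*-congˡ {sgn j} (split i j)) (distribˡ (sgn j) (P i j) (Q i j))) ⟩
    ▵ (suc k) (λ i j → sgn j * P i j + sgn j * Q i j)
      ≈⟨ ▵-+ (suc k) (λ i j → sgn j * P i j) (λ i j → sgn j * Q i j) ⟩
    ▵ (suc k) (λ i j → sgn j * P i j) + ▵ (suc k) (λ i j → sgn j * Q i j)
      -- Without the vanishing end terms both sums run over the same indices: lowering the degree
      -- and the exponent of x₁ together changes no coefficient, so `P i (suc j)` and `Q (suc i) j`
      -- both reduce to `X i j`.
      ≈⟨ +-cong
           (trans (▵-last k (λ i j → sgn j * P i j)) (trans (+-congˡ (trans (*-congˡ last) (zeroʳ _))) (+-identityʳ _)))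
           (trans (+-congʳ (trans (*-congˡ first) (zeroʳ _))) (+-identityˡ _)) ⟩
    ▵ k (λ i j → sgn (suc j) * X i j) + ▵ k (λ i j → sgn j * X i j)
      ≈⟨ ▵-+ k (λ i j → sgn (suc j) * X i j) (λ i j → sgn j * X i j) ⟨
    ▵ k (λ i j → sgn (suc j) * X i j + sgn j * X i j)
      ≈⟨ ▵-zero k (λ i j _ → trans (+-congʳ (sgn-suc-* j _)) (-‿inverseˡ _)) ⟩
    0# ∎
    where
    P Q X : ℕ → ℕ → Carrier
    P i j = cauchy (E i) (slice (H j) (suc n)) α
    Q i j = cauchy (slice (E i) 1) (slice (H j) n) α
    X i j = cauchy (E i) (slice (H j) n) α
    last : P (suc k) 0 ≈ 0#
    last = trans (cauchy-comm (E (suc k)) (slice (H 0) (suc n)) α)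
      (cauchy-zeroˡ {slice (H 0) (suc n)} (E (suc k)) (λ _ → refl) α)
    first : Q 0 (suc k) ≈ 0#
    first = cauchy-zeroˡ {slice (E 0) 1} (slice (H (suc k)) n) (λ _ → refl) α
    head : ∀ n (f : ℕ → ℕ → Carrier) → (∀ i j → f (suc i) j ≈ 0#) → ▵ n f ≈ f 0 n
    head zero    f p = refl
    head (suc n) f p = trans (+-congˡ (▵-zero n λ i j _ → p i j)) (+-identityʳ _)
    -- `e i` is at most linear in x₁, so only its slices at exponents 0 and 1 contribute.
    split : ∀ i j → cauchy (E i) (H j) (suc n ∷ α) ≈ P i j + Q i j
    split i j = trans (cauchy-▵ (E i) (H j) (suc n) α)
      (+-congˡ (head n (λ a b → cauchy (slice (E i) (suc a)) (slice (H j) b) α) λ a b →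
        cauchy-zeroˡ {slice (E i) (suc (suc a))} (slice (H j) b) (slice-e-≥2 i a) α))

  -- The coefficients of H(-t).
  signed-h : ℕ → Λ
  signed-h j = sgn j · h j

  open FactorialMatrix Λ-commutativeRing using (_⋆_; one)

  e₀≋𝟙 : e 0 ≋ 𝟙
  e₀≋𝟙 α = indicator-⇔ (squarefree? 0 α) (sum α ℕ.≟ 0) proj₁ (λ eq → eq , small α eq)
    where
    small : ∀ α → sum α ≡ 0 → All (ℕ._≤ 1) α
    small []         _  = []
    small (zero ∷ α) eq = z≤n ∷ small α eq

  e⋆signed-h : ∀ k → (e ⋆ signed-h) k ≋ one k
  e⋆signed-h zero    α = trans (cauchy-comm (E 0) (coeff (signed-h 0)) α)
    (trans (cauchy-*ˡ 1# (H 0) (E 0) α) (trans (*-identityˡ _)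
      (trans (cauchy-identityˡ (E 0) α) (e₀≋𝟙 α))))
  e⋆signed-h (suc k) α = trans
    (reflexive (coeff-▵ (suc k) (λ i j → e i ⊗ signed-h j) α))
    (trans (▵-cong′ (suc k) λ i j → trans (cauchy-comm (E i) (coeff (signed-h j)) α)
      (trans (cauchy-*ˡ (sgn j) (H j) (E i) α) (*-congˡ (cauchy-comm (H j) (E i) α))))
    (e-h-orthogonal k α))

-- The transposed diagram as a conjugate pair of row and column lengths.

module ColumnLengths where

  row-suc≤ : ∀ {m ms} → Linked ℕ._≥_ (m ∷ ms) → ∀ i → row ms i ℕ.≤ m
  row-suc≤ [-]        i       = z≤n
  row-suc≤ (m≥n ∷ _)  zero    = m≥n
  row-suc≤ (m≥n ∷ ns) (suc i) = ℕ.≤-trans (row-suc≤ ns i) m≥n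

  row⇒columnLength : ∀ {ms} → Linked ℕ._≥_ ms → ∀ {i j} → j ℕ.< row ms i → i ℕ.< columnLength ms j
  row⇒columnLength {m ∷ ms} l {i} {j} lt with j ℕ.<? m
  row⇒columnLength {m ∷ ms} l {zero}  {j} lt | yes j<m
    rewrite filter-accept (j ℕ.<?_) {xs = ms} j<m = z<s
  row⇒columnLength {m ∷ ms} l {suc i} {j} lt | yes j<m
    rewrite filter-accept (j ℕ.<?_) {xs = ms} j<m = s<s (row⇒columnLength (Linked.tail l) lt)
  row⇒columnLength {m ∷ ms} l {zero}  {j} lt | no j≮m = contradiction lt j≮m
  row⇒columnLength {m ∷ ms} l {suc i} {j} lt | no j≮m =
    contradiction (ℕ.<-≤-trans lt (row-suc≤ l i)) j≮m

  columnLength⇒row : ∀ {ms} → Linked ℕ._≥_ ms → ∀ {i j} → i ℕ.< columnLength ms j → j ℕ.< row ms i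
  columnLength⇒row {m ∷ ms} l {i} {j} lt with j ℕ.<? m
  columnLength⇒row {m ∷ ms} l {zero}  {j} lt | yes j<m = j<m
  columnLength⇒row {m ∷ ms} l {suc i} {j} lt | yes j<m
    rewrite filter-accept (j ℕ.<?_) {xs = ms} j<m =
    columnLength⇒row (Linked.tail l) (ℕ.≤-pred lt)
  columnLength⇒row {m ∷ ms} l {i} {j} lt | no j≮m
    rewrite filter-reject (j ℕ.<?_) {xs = ms} j≮m =
    contradiction (ℕ.<-≤-trans (columnLength⇒row (Linked.tail l) lt) (row-suc≤ l i)) j≮m

  row-applyUpTo : ∀ f n j → j ℕ.< n → row (applyUpTo f n) j ≡ f j
  row-applyUpTo f (suc n) zero    _         = ≡.refl
  row-applyUpTo f (suc n) (suc j) (s<s j<n) = row-applyUpTo (f ∘ suc) n j j<n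

  row-length : ∀ ms i → length ms ℕ.≤ i → row ms i ≡ 0
  row-length []       i       _        = ≡.refl
  row-length (m ∷ ms) (suc i) (s≤s le) = row-length ms i le

  -- Beyond the listed columns `row` gives 0, and so does `columnLength`, as a nonempty column would
  -- meet the first row.
  row-′ : ∀ μ j → row (rows (μ ′)) j ≡ columnLength (rows μ) j
  row-′ μ j with j ℕ.<? row (rows μ) 0
  ... | yes lt = row-applyUpTo (columnLength (rows μ)) _ j lt
  ... | no ≮  = ≡.trans
    (row-length (rows (μ ′)) j (≡.subst (ℕ._≤ j)
      (≡.sym (length-applyUpTo (columnLength (rows μ)) (row (rows μ) 0))) (ℕ.≮⇒≥ ≮)))
    (≡.sym (ℕ.n≤0⇒n≡0 (ℕ.≮⇒≥ λ pos → ≮ (columnLength⇒row (decreasing μ) pos))))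

  conjugate : ∀ μ {N M} → ℓ μ ℕ.≤ N → ℓ (μ ′) ℕ.≤ M →
    Conjugate (row (rows μ)) (row (rows (μ ′))) N M
  conjugate μ {N} {M} ℓ≤N ℓ′≤M = record
    { row⇒col = row⇒col
    ; col⇒row = col⇒row
    ; r≤M = λ i → ℕ.≮⇒≥ λ lt → ℕ.<⇒≱ (r-bounded (ℕ.≤-<-trans z≤n (row⇒col lt))) ℓ′≤M
    ; c≤N = λ j → ℕ.≮⇒≥ λ lt → ℕ.<⇒≱ (ℕ.≤-<-trans z≤n (col⇒row lt))
        (ℕ.≤-reflexive (row-length (rows μ) N ℓ≤N))
    }
    where
    row⇒col : ∀ {i j} → j ℕ.< row (rows μ) i → i ℕ.< row (rows (μ ′)) j
    row⇒col {i} {j} lt = ≡.subst (i ℕ.<_) (≡.sym (row-′ μ j)) (row⇒columnLength (decreasing μ) lt)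
    col⇒row : ∀ {i j} → i ℕ.< row (rows (μ ′)) j → j ℕ.< row (rows μ) i
    col⇒row {i} {j} lt = columnLength⇒row (decreasing μ) (≡.subst (i ℕ.<_) (row-′ μ j) lt)
    r-bounded : ∀ {j} → 0 ℕ.< row (rows (μ ′)) j → j ℕ.< ℓ (μ ′)
    r-bounded {j} pos = ℕ.≰⇒> λ le → ℕ.<⇒≢ pos (≡.sym (row-length (rows (μ ′)) j le))

-- Integer indices in terms of the shifted natural positions.

module Indices where
  open ≡.≡-Reasoning
  open +-*-Solver

  row-index : ∀ {N r i j p q} → p ℕ.+ suc i ≡ N ℕ.+ r → q ℕ.+ suc j ≡ N →
    + r ℤ.- + suc i ℤ.+ + suc j ≡ + p ℤ.- + q
  row-index {N} {r} {i} {j} {p} {q} eqp eqq = begin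
    + r ℤ.- + suc i ℤ.+ + suc j
      ≡⟨ solve 4 (λ R I J M → R :- I :+ J := (M :+ R) :- I :+ J :- M) ≡.refl (+ r) (+ suc i) (+ suc j) (+ N) ⟩
    + (N ℕ.+ r) ℤ.- + suc i ℤ.+ + suc j ℤ.- + N
      ≡⟨ ≡.cong₂ (λ s t → + s ℤ.- + suc i ℤ.+ + suc j ℤ.- + t) eqp eqq ⟨
    + (p ℕ.+ suc i) ℤ.- + suc i ℤ.+ + suc j ℤ.- + (q ℕ.+ suc j)
      ≡⟨ solve 4 (λ P I J Q → P :+ I :- I :+ J :- (Q :+ J) := P :- Q) ≡.refl (+ p) (+ suc i) (+ suc j) (+ q) ⟩
    + p ℤ.- + q ∎

  column-index : ∀ {N c i j u} → u ℕ.+ c ≡ N ℕ.+ i →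
    + c ℤ.- + suc i ℤ.+ + suc j ≡ + (N ℕ.+ j) ℤ.- + u
  column-index {N} {c} {i} {j} {u} eq = begin
    + c ℤ.- + suc i ℤ.+ + suc j
      ≡⟨ solve 4 (λ C I J U → C :- (con (+ 1) :+ I) :+ (con (+ 1) :+ J) := (U :+ C) :+ J :- I :- U)
           ≡.refl (+ c) (+ i) (+ j) (+ u) ⟩
    + (u ℕ.+ c) ℤ.+ + j ℤ.- + i ℤ.- + u
      ≡⟨ ≡.cong (λ s → + s ℤ.+ + j ℤ.- + i ℤ.- + u) eq ⟩
    + (N ℕ.+ i) ℤ.+ + j ℤ.- + i ℤ.- + u
      ≡⟨ solve 4 (λ M I J U → (M :+ I) :+ J :- I :- U := (M :+ J) :- U) ≡.refl (+ N) (+ i) (+ j) (+ u) ⟩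
    + (N ℕ.+ j) ℤ.- + u ∎

  row-variable : ∀ {N j q} n → q ℕ.+ suc j ≡ N →
    + suc n ℤ.+ (+ 1 ℤ.- + suc j) ≡ + suc (suc (n ℕ.+ q)) ℤ.- + N
  row-variable {N} {j} {q} n eq = begin
    + suc n ℤ.+ (+ 1 ℤ.- + suc j)
      ≡⟨ solve 3 (λ X J Q → con (+ 1) :+ X :+ (con (+ 1) :- J) := con (+ 2) :+ (X :+ Q) :- (Q :+ J))
           ≡.refl (+ n) (+ suc j) (+ q) ⟩
    + suc (suc (n ℕ.+ q)) ℤ.- + (q ℕ.+ suc j)
      ≡⟨ ≡.cong (λ s → + suc (suc (n ℕ.+ q)) ℤ.- + s) eq ⟩
    + suc (suc (n ℕ.+ q)) ℤ.- + N ∎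

  -- The reflection in the dual sequence reverses the order of the parameters: variable number `n`
  -- of a column entry sits at `m - n - 1` from the bottom of its range.
  column-variable : ∀ {N j u m w} n → suc (m ℕ.+ u) ≡ N ℕ.+ j → w ℕ.+ suc n ≡ m →
    + 1 ℤ.- (+ suc n ℤ.+ (+ 1 ℤ.- + suc j)) ≡ + suc (suc (w ℕ.+ u)) ℤ.- + N
  column-variable {N} {j} {u} {m} {w} n eq ≡.refl = begin
    + 1 ℤ.- (+ suc n ℤ.+ (+ 1 ℤ.- + suc j))
      ≡⟨ solve 3 (λ X J M → con (+ 1) :- (con (+ 1) :+ X :+ (con (+ 1) :- (con (+ 1) :+ J)))
           := (M :+ J) :- X :- M) ≡.refl (+ n) (+ j) (+ N) ⟩
    + (N ℕ.+ j) ℤ.- + n ℤ.- + N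
      ≡⟨ ≡.cong (λ s → + s ℤ.- + n ℤ.- + N) eq ⟨
    + suc (w ℕ.+ suc n ℕ.+ u) ℤ.- + n ℤ.- + N
      ≡⟨ solve 4 (λ W X U M → con (+ 1) :+ (W :+ (con (+ 1) :+ X) :+ U) :- X :- M
           := con (+ 2) :+ (W :+ U) :- M) ≡.refl (+ w) (+ n) (+ u) (+ N) ⟩
    + suc (suc (w ℕ.+ u)) ℤ.- + N ∎

  p-q<0 : ∀ {p q} → p ℕ.< q → + p ℤ.- + q ≡ -[1+ q ℕ.∸ suc p ]
  p-q<0 {p} {suc q} (s≤s p≤q) = ≡.trans (ℤ.m-n≡m⊖n p (suc q)) (≡.trans (ℤ.⊖-< (s≤s p≤q))
    (≡.cong (λ t → ℤ.- + t) (ℕ.+-∸-assoc 1 p≤q)))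

  p-q>0 : ∀ m q → + suc (m ℕ.+ q) ℤ.- + q ≡ + suc m
  p-q>0 m q = solve 2 (λ M Q → con (+ 1) :+ (M :+ Q) :- Q := con (+ 1) :+ M) ≡.refl (+ m) (+ q)

-- Ring homomorphisms applied to determinants and antidiagonal sums.

module DeterminantHomomorphism {c₁ ℓ₁ c₂ ℓ₂} (R₁ : CommutativeRing c₁ ℓ₁) (R₂ : CommutativeRing c₂ ℓ₂)
  {⟦_⟧ : CommutativeRing.Carrier R₁ → CommutativeRing.Carrier R₂}
  (isHom : RingMorphisms.IsRingHomomorphism
    (CommutativeRing.rawRing R₁) (CommutativeRing.rawRing R₂) ⟦_⟧) where
  private module A = CommutativeRing R₁
  open CommutativeRing R₂ hiding (zero)
  open RingMorphisms.IsRingHomomorphism isHom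
  open SemiringSum A.semiring using () renaming (sum to ∑₁)
  open SemiringSum semiring using () renaming (sum to ∑₂)
  open Determinant A.rawRing using () renaming (det to det₁)
  open Determinant rawRing using () renaming (det to det₂)
  open Forms R₁ using () renaming (sgn to sgn₁)
  open Forms R₂ using (∑-cong) renaming (sgn to sgn₂)
  private
    module ▵₁ = Antidiagonal R₁
    module ▵₂ = Antidiagonal R₂

  ∑-homo : ∀ n (f : Fin n → A.Carrier) → ⟦ ∑₁ f ⟧ ≈ ∑₂ (λ i → ⟦ f i ⟧)
  ∑-homo zero    f = 0#-homo
  ∑-homo (suc n) f = trans (+-homo _ _) (+-congˡ (∑-homo n (f ∘ fsuc)))

  sgn-homo : ∀ n → ⟦ sgn₁ n ⟧ ≈ sgn₂ n
  sgn-homo zero    = 1#-homo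
  sgn-homo (suc n) = trans (*-homo _ _)
    (*-cong (trans (-‿homo _) (-‿cong 1#-homo)) (sgn-homo n))

  det-homo : ∀ n (M : Fin n → Fin n → A.Carrier) → ⟦ det₁ M ⟧ ≈ det₂ (λ i j → ⟦ M i j ⟧)
  det-homo zero    M = 1#-homo
  det-homo (suc n) M = trans
    (∑-homo (suc n) (λ j → (sgn₁ (toℕ j) A.* M fzero j) A.* det₁ (minor j)))
    (∑-cong (suc n) λ j → trans (*-homo (sgn₁ (toℕ j) A.* M fzero j) (det₁ (minor j)))
      (*-cong (trans (*-homo (sgn₁ (toℕ j)) (M fzero j)) (*-congʳ {⟦ M fzero j ⟧} (sgn-homo (toℕ j))))
        (det-homo n (minor j))))
    where
    minor : Fin (suc n) → Fin n → Fin n → A.Carrier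
    minor j i k = M (fsuc i) (punchIn j k)

  ▵-homo : ∀ n f → ⟦ ▵₁.▵ n f ⟧ ≈ ▵₂.▵ n (λ i j → ⟦ f i j ⟧)
  ▵-homo zero    f = refl
  ▵-homo (suc n) f = trans (+-homo _ _) (+-congˡ (▵-homo n λ i → f (suc i)))

-- The entries of the two determinants, and the duality.

module MultiparameterSchur {c r} (K : CommutativeRing c r) where
  open CommutativeRing K hiding (zero)
  open RingProperties ring
  open CommutativeSemigroupProperties
    (CommutativeMonoid.commutativeSemigroup *-commutativeMonoid) using (x∙yz≈y∙xz)
  open SymmetricFunctions K
  open SymmetricFunctionRing K
  open Forms K using (sgn; sgn-suc-*; sgn-+; sgn-double; sgn-cancel)
  open FactorialMatrix K using (C)
  private
    module K-Reasoning = SetoidReasoning setoid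
    module ΛR = CommutativeRing Λ-commutativeRing
    module ΛF = FactorialMatrix Λ-commutativeRing
    module ΛForms = Forms Λ-commutativeRing
  open Antidiagonal Λ-commutativeRing using (▵; ▵-cong; ▵-cong′; ▵-*ˡ; ∑-▵)
  open SetoidReasoning ΛR.setoid

  -- `elementary` recurses on the head of the list, whereas `C` multiplies by its last factor;
  -- splitting at the end reconciles them.
  elementary-∷ʳ : ∀ k xs x →
    elementary (suc k) (xs ∷ʳ x) ≈ x * elementary k xs + elementary (suc k) xs
  elementary-∷ʳ zero    []       x = refl
  elementary-∷ʳ (suc k) []       x = refl
  elementary-∷ʳ zero    (y ∷ xs) x = trans (+-congˡ (elementary-∷ʳ zero xs x))
    (trans (sym (+-assoc _ _ _)) (trans (+-congʳ (+-comm _ _)) (+-assoc _ _ _)))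
  elementary-∷ʳ (suc k) (y ∷ xs) x = K-Reasoning.begin
    y * elementary (suc k) (xs ∷ʳ x) + elementary (suc (suc k)) (xs ∷ʳ x)
      K-Reasoning.≈⟨ +-cong (*-congˡ (elementary-∷ʳ k xs x)) (elementary-∷ʳ (suc k) xs x) ⟩
    y * (x * E₀ + E₁) + (x * E₁ + E₂)
      K-Reasoning.≈⟨ +-congʳ (trans (distribˡ _ _ _) (+-congʳ (x∙yz≈y∙xz y x E₀))) ⟩
    (x * (y * E₀) + y * E₁) + (x * E₁ + E₂)
      K-Reasoning.≈⟨ interchange _ _ _ _ ⟩
    (x * (y * E₀) + x * E₁) + (y * E₁ + E₂)
      K-Reasoning.≈⟨ +-congʳ (distribˡ _ _ _) ⟨
    x * (y * E₀ + E₁) + (y * E₁ + E₂) K-Reasoning.∎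
    where
    open CommutativeSemigroupProperties
      (CommutativeMonoid.commutativeSemigroup +-commutativeMonoid) using (interchange)
    E₀ = elementary k xs
    E₁ = elementary (suc k) xs
    E₂ = elementary (suc (suc k)) xs

  elementary-C : ∀ {β g} → (∀ n → g n ≈ β n) → ∀ m d →
    sgn d * elementary d (applyUpTo g m) ≈ C β m d
  elementary-C p m       zero    = *-identityˡ 1#
  elementary-C p zero    (suc d) = zeroʳ _
  elementary-C {β} {g} p (suc m) (suc d) = K-Reasoning.begin
    sgn (suc d) * elementary (suc d) (applyUpTo g (suc m))
      K-Reasoning.≈⟨ *-congˡ (trans
        (reflexive (≡.cong (elementary (suc d)) (≡.sym (applyUpTo-∷ʳ g m))))
        (trans (elementary-∷ʳ d xs (g m)) (+-comm _ _))) ⟩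
    sgn (suc d) * (elementary (suc d) xs + g m * elementary d xs)
      K-Reasoning.≈⟨ distribˡ _ _ _ ⟩
    sgn (suc d) * elementary (suc d) xs + sgn (suc d) * (g m * elementary d xs)
      K-Reasoning.≈⟨ +-cong (elementary-C p m (suc d))
        (trans (sgn-suc-* d _) (-‿cong (trans (x∙yz≈y∙xz _ _ _) (*-cong (p m) (elementary-C p m d))))) ⟩
    C β m (suc d) - β m * C β m d K-Reasoning.∎
    where xs = applyUpTo g m

  -- In reversed order the head of the list is the last factor of `C`, so the recursions agree as
  -- they stand; the negated variables absorb the sign that `elementary-C` carries.
  elementary-C-reverse : ∀ {β g} m → (∀ {n} → n ℕ.< m → g n ≈ - β (m ℕ.∸ suc n)) → ∀ d →
    elementary d (applyUpTo g m) ≈ C β m d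
  elementary-C-reverse m       p zero    = refl
  elementary-C-reverse zero    p (suc d) = refl
  elementary-C-reverse {β} {g} (suc m) p (suc d) = trans (+-comm _ _) (+-cong
    (elementary-C-reverse m (p ∘ s<s) (suc d))
    (trans (*-cong (p z<s) (elementary-C-reverse m (p ∘ s<s) d)) (sym (-‿distribˡ-* _ _))))

  -- The matrices `F` have parameters and series in one ring, so the scalars `a i` are viewed in
  -- `Λ`.
  embed : Carrier → Λ
  embed x = x · 𝟙

  embed-⊗ : ∀ x f → embed x ⊗ f ≋ x · f
  embed-⊗ x f α = trans (cauchy-*ˡ x (coeff 𝟙) (coeff f) α) (*-congˡ (cauchy-identityˡ (coeff f) α))

  embed-C : ∀ β m d → ΛF.C (embed ∘ β) m d ≋ embed (C β m d)
  embed-C β m       zero    α = sym (*-identityˡ _)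
  embed-C β zero    (suc d) α = sym (zeroˡ _)
  embed-C β (suc m) (suc d) α = trans
    (+-cong (embed-C β m (suc d) α) (-‿cong (trans (embed-⊗ (β m) (ΛF.C (embed ∘ β) m d) α)
      (trans (*-congˡ (embed-C β m d α)) (sym (*-assoc _ _ _))))))
    (sym (trans (distribʳ _ _ _) (+-congˡ (sym (-‿distribˡ-* _ _)))))

  embed-sgn : ∀ n → ΛForms.sgn n ≋ embed (sgn n)
  embed-sgn zero    α = sym (*-identityˡ _)
  embed-sgn (suc n) = begin
    ΛForms.sgn (suc n)        ≈⟨ ΛR.*-identityʳ (ΛForms.sgn (suc n)) ⟨
    ΛForms.sgn (suc n) ⊗ 𝟙    ≈⟨ ΛForms.sgn-suc-* n 𝟙 ⟩
    ⊖ (ΛForms.sgn n ⊗ 𝟙)      ≈⟨ (λ α → -‿cong (ΛR.*-identityʳ (ΛForms.sgn n) α)) ⟩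
    ⊖ ΛForms.sgn n            ≈⟨ (λ α → -‿cong (embed-sgn n α)) ⟩
    ⊖ embed (sgn n)           ≈⟨ (λ α → trans (-‿distribˡ-* _ _) (*-congʳ (sym (-1*x≈-x _)))) ⟩
    embed (sgn (suc n))       ∎

  hₐ-▵ : ∀ m a → hₐ (+ suc m) a ≋
    ▵ m λ i d → (sgn d * elementary d (applyUpTo (λ n → a (+ suc n)) m)) · h (suc i)
  hₐ-▵ m a = ∑-▵ m λ i d → (sgn d * elementary d (applyUpTo (λ n → a (+ suc n)) m)) · h (suc i)

  -- The term with `h (suc i)` keeps the sign (-1)^d on the left, and gets (-1)^(i+1) from
  -- `signed-h` on the right. Since d + i + 1 = v - u has the parity of u + v, the outer sign
  -- accounts for the difference.
  column-entry : ∀ (b : ℕ → Carrier) {k} (a : Sequence) u v → k ≡ + v ℤ.- + u →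
    (∀ {m n} → n ℕ.< m → v ≡ suc (m ℕ.+ u) → a (+ suc n) ≈ - b (suc (m ℕ.∸ suc n ℕ.+ u))) →
    hₐ k a ≋ ΛForms.sgn (u ℕ.+ v) ⊗ ΛF.F (embed ∘ b) signed-h v u
  column-entry b a u v ≡.refl var with ℕ.<-cmp v u
  ... | tri< v<u _ _ rewrite Indices.p-q<0 v<u = begin
    𝟘
      ≈⟨ ΛR.zeroʳ σ ⟨
    σ ⊗ 𝟘
      ≈⟨ ΛR.*-cong {σ} {σ} {𝟘} {F} (λ _ → refl) (ΛR.sym {F} {𝟘} (ΛF.F-upper (embed ∘ b) signed-h v<u)) ⟩
    σ ⊗ F ∎
    where
    σ = ΛForms.sgn (u ℕ.+ v)
    F = ΛF.F (embed ∘ b) signed-h v u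
  ... | tri≈ _ ≡.refl _ rewrite ℤ.+-inverseʳ (+ u) = begin
    𝟙
      ≈⟨ (λ α → *-identityˡ (coeff 𝟙 α)) ⟨
    signed-h 0
      ≈⟨ ΛR.*-identityˡ (signed-h 0) ⟨
    𝟙 ⊗ signed-h 0
      ≈⟨ ΛR.*-cong {σ} {𝟙} {F} {signed-h 0} (ΛForms.sgn-double u) (ΛF.F-diagonal (embed ∘ b) signed-h u) ⟨
    σ ⊗ F ∎
    where
    σ = ΛForms.sgn (u ℕ.+ u)
    F = ΛF.F (embed ∘ b) signed-h u u
  ... | tri> _ _ u<v with v ℕ.∸ suc u | ≡.trans (≡.sym (ℕ.m∸n+n≡m u<v)) (ℕ.+-suc (v ℕ.∸ suc u) u)
  ...   | m | ≡.refl rewrite Indices.p-q>0 m u = begin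
    hₐ (+ suc m) a
      ≈⟨ hₐ-▵ m a ⟩
    ▵ m (λ i d → (sgn d * elementary d (applyUpTo (λ n → a (+ suc n)) m)) · h (suc i))
      ≈⟨ ▵-cong m (λ i d i+d≡m α → trans (*-congʳ (scalars i d i+d≡m))
           (trans (*-assoc _ _ _) (trans (*-assoc _ _ _) (sym (product i d α))))) ⟩
    ▵ m (λ i d → σ ⊗ (ΛF.C (embed ∘ β) m d ⊗ signed-h (suc i)))
      ≈⟨ ▵-*ˡ m σ (λ i d → ΛF.C (embed ∘ β) m d ⊗ signed-h (suc i)) ⟨
    σ ⊗ ▵ m (λ i d → ΛF.C (embed ∘ β) m d ⊗ signed-h (suc i))
      ≈⟨ ΛR.*-congˡ {σ} {ΛF.F (embed ∘ b) signed-h (suc (m ℕ.+ u)) u}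
           {▵ m λ i d → ΛF.C (embed ∘ β) m d ⊗ signed-h (suc i)} (ΛF.F-C (embed ∘ b) signed-h m u) ⟨
    σ ⊗ ΛF.F (embed ∘ b) signed-h (suc (m ℕ.+ u)) u ∎
    where
    σ = ΛForms.sgn (u ℕ.+ suc (m ℕ.+ u))
    t = sgn (u ℕ.+ suc (m ℕ.+ u))
    β : ℕ → Carrier
    β x = b (suc (x ℕ.+ u))
    product : ∀ i d → σ ⊗ (ΛF.C (embed ∘ β) m d ⊗ signed-h (suc i)) ≋ t · C β m d · signed-h (suc i)
    product i d = begin
      σ ⊗ (ΛF.C (embed ∘ β) m d ⊗ signed-h (suc i))
        ≈⟨ ΛR.*-cong {σ} {embed t} {ΛF.C (embed ∘ β) m d ⊗ signed-h (suc i)} {embed (C β m d) ⊗ signed-h (suc i)}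
             (embed-sgn (u ℕ.+ suc (m ℕ.+ u)))
             (ΛR.*-congʳ {signed-h (suc i)} {ΛF.C (embed ∘ β) m d} {embed (C β m d)} (embed-C β m d)) ⟩
      embed t ⊗ (embed (C β m d) ⊗ signed-h (suc i))
        ≈⟨ embed-⊗ t (embed (C β m d) ⊗ signed-h (suc i)) ⟩
      t · (embed (C β m d) ⊗ signed-h (suc i))
        ≈⟨ (λ α → *-congˡ (embed-⊗ (C β m d) (signed-h (suc i)) α)) ⟩
      t · C β m d · signed-h (suc i) ∎
    -- The surplus `u + u` is even, so `t` has the sign of d + i + 1.
    parity : ∀ i d → i ℕ.+ d ≡ m → u ℕ.+ suc (m ℕ.+ u) ≡ d ℕ.+ suc i ℕ.+ (u ℕ.+ u)
    parity i d eq = ≡.trans (ℕ.+-comm u (suc (m ℕ.+ u))) (≡.trans (ℕ.+-assoc (suc m) u u)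
      (≡.cong (ℕ._+ (u ℕ.+ u)) (≡.trans (≡.cong suc (≡.trans (≡.sym eq) (ℕ.+-comm i d))) (≡.sym (ℕ.+-suc d i)))))
    t≈ : ∀ i d → i ℕ.+ d ≡ m → t ≈ sgn d * sgn (suc i)
    t≈ i d eq = trans (reflexive (≡.cong sgn (parity i d eq))) (trans (sgn-+ (d ℕ.+ suc i) (u ℕ.+ u))
      (trans (*-congˡ (sgn-double u)) (trans (*-identityʳ _) (sgn-+ d (suc i)))))
    scalars : ∀ i d → i ℕ.+ d ≡ m →
      sgn d * elementary d (applyUpTo (λ n → a (+ suc n)) m) ≈ (t * C β m d) * sgn (suc i)
    scalars i d eq = K-Reasoning.begin
      sgn d * elementary d (applyUpTo (λ n → a (+ suc n)) m)
        K-Reasoning.≈⟨ *-congˡ (elementary-C-reverse m (λ n<m → var n<m ≡.refl) d) ⟩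
      sgn d * C β m d
        K-Reasoning.≈⟨ *-congˡ (sgn-cancel (suc i) _) ⟨
      sgn d * (sgn (suc i) * (sgn (suc i) * C β m d))
        K-Reasoning.≈⟨ *-assoc _ _ _ ⟨
      (sgn d * sgn (suc i)) * (sgn (suc i) * C β m d)
        K-Reasoning.≈⟨ *-congʳ (t≈ i d eq) ⟨
      t * (sgn (suc i) * C β m d)
        K-Reasoning.≈⟨ trans (*-congˡ (*-comm _ _)) (sym (*-assoc _ _ _)) ⟩
      (t * C β m d) * sgn (suc i) K-Reasoning.∎

  module _ {ω : Λ → Λ} (isOmega : IsOmega ω) where
    open IsOmega isOmega
    open RingMorphisms.IsRingIsomorphism isRingIsomorphism using (isRingHomomorphism; 0#-homo; 1#-homo)
    open RingMorphisms.IsRingIsomorphism isRingIsomorphism using () renaming (⟦⟧-cong to ω-cong)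
    open DeterminantHomomorphism Λ-commutativeRing Λ-commutativeRing isRingHomomorphism

    -- `ω` keeps scalars and turns `h` into `e`, and the signs in `hₐ` are those in the expansion of
    -- the product; unlike for columns, no further sign is left.
    row-entry : ∀ (b : ℕ → Carrier) {k} (a : Sequence) p q → k ≡ + p ℤ.- + q →
      (∀ n → a (+ suc n) ≈ b (suc (n ℕ.+ q))) →
      ω (hₐ k a) ≋ ΛF.F (embed ∘ b) e p q
    row-entry b a p q ≡.refl var with ℕ.<-cmp p q
    ... | tri< p<q _ _ rewrite Indices.p-q<0 p<q = begin
      ω 𝟘 ≈⟨ 0#-homo ⟩
      𝟘   ≈⟨ ΛF.F-upper (embed ∘ b) e p<q ⟨
      ΛF.F (embed ∘ b) e p q ∎
    ... | tri≈ _ ≡.refl _ rewrite ℤ.+-inverseʳ (+ p) = begin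
      ω 𝟙 ≈⟨ 1#-homo ⟩
      𝟙   ≈⟨ e₀≋𝟙 ⟨
      e 0 ≈⟨ ΛF.F-diagonal (embed ∘ b) e p ⟨
      ΛF.F (embed ∘ b) e p p ∎
    ... | tri> _ _ q<p with p ℕ.∸ suc q | ≡.trans (≡.sym (ℕ.m∸n+n≡m q<p)) (ℕ.+-suc (p ℕ.∸ suc q) q)
    ...   | m | ≡.refl rewrite Indices.p-q>0 m q = begin
      ω (hₐ (+ suc m) a)
        ≈⟨ ω-cong (hₐ-▵ m a) ⟩
      ω (▵ m (λ i d → x d · h (suc i)))
        ≈⟨ ▵-homo m (λ i d → x d · h (suc i)) ⟩
      ▵ m (λ i d → ω (x d · h (suc i)))
        ≈⟨ ▵-cong′ m (λ i d α → trans (·-homo (x d) (h (suc i)) α)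
             (trans (*-cong (elementary-C var m d) (h↦e (suc i) α)) (sym (product i d α)))) ⟩
      ▵ m (λ i d → ΛF.C (embed ∘ β) m d ⊗ e (suc i))
        ≈⟨ ΛF.F-C (embed ∘ b) e m q ⟨
      ΛF.F (embed ∘ b) e (suc (m ℕ.+ q)) q ∎
      where
      β : ℕ → Carrier
      β y = b (suc (y ℕ.+ q))
      x : ℕ → Carrier
      x d = sgn d * elementary d (applyUpTo (λ n → a (+ suc n)) m)
      product : ∀ i d → ΛF.C (embed ∘ β) m d ⊗ e (suc i) ≋ C β m d · e (suc i)
      product i d = begin
        ΛF.C (embed ∘ β) m d ⊗ e (suc i)
          ≈⟨ ΛR.*-congʳ {e (suc i)} {ΛF.C (embed ∘ β) m d} {embed (C β m d)} (embed-C β m d) ⟩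
        embed (C β m d) ⊗ e (suc i)
          ≈⟨ embed-⊗ (C β m d) (e (suc i)) ⟩
        C β m d · e (suc i) ∎

    ω-s : ∀ a μ N M → ℓ μ ℕ.≤ N → ℓ (μ ′) ℕ.≤ M → ω (s N μ a) ≋ s M (μ ′) (dual a)
    ω-s a μ N M ℓ≤N ℓ′≤M = begin
      ω (s N μ a)
        ≈⟨ det-homo N (λ i j → row-matrix (toℕ i) (toℕ j)) ⟩
      det {N} (λ i j → ω (row-matrix (toℕ i) (toℕ j)))
        ≈⟨ ΛForms.det-cong {N} (λ i j → rows-agree (toℕ<n i) (toℕ<n j)) ⟩
      det {N} (λ i j → ΛF.F (embed ∘ b) e ((N ℕ.+ row (rows μ) (toℕ i)) ℕ.∸ suc (toℕ i)) (N ℕ.∸ suc (toℕ j)))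
        ≈⟨ ΛF.complementary-minors-F (ColumnLengths.conjugate μ ℓ≤N ℓ′≤M) (embed ∘ b) e signed-h e⋆signed-h e₀≋𝟙 ⟩
      det {M} (λ i j → ΛForms.sgn (colPos (toℕ i) ℕ.+ (N ℕ.+ toℕ j)) ⊗
        ΛF.F (embed ∘ b) signed-h (N ℕ.+ toℕ j) (colPos (toℕ i)))
        ≈⟨ ΛForms.det-cong {M} (λ i j → columns-agree (toℕ i) (toℕ j)) ⟨
      s M (μ ′) (dual a) ∎
      where
      open Determinant Λ-rawRing using (det)
      open Boundary (ColumnLengths.conjugate μ ℓ≤N ℓ′≤M) using (colPos; colPos+)
      -- Position x carries the parameter with index x + 1 - N, which undoes the shift of the
      -- positions by `N`.
      b : ℕ → Carrier
      b x = a (+ suc x ℤ.- + N)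
      row-matrix column-matrix : ℕ → ℕ → Λ
      row-matrix i j = hₐ (+ row (rows μ) i ℤ.- + suc i ℤ.+ + suc j) (τ (+ 1 ℤ.- + suc j) a)
      column-matrix i j = hₐ (+ row (rows (μ ′)) i ℤ.- + suc i ℤ.+ + suc j) (τ (+ 1 ℤ.- + suc j) (dual a))
      rows-agree : ∀ {i j} → i ℕ.< N → j ℕ.< N → ω (row-matrix i j) ≋
        ΛF.F (embed ∘ b) e ((N ℕ.+ row (rows μ) i) ℕ.∸ suc i) (N ℕ.∸ suc j)
      rows-agree {i} {j} i<N j<N = row-entry b (τ (+ 1 ℤ.- + suc j) a)
        ((N ℕ.+ row (rows μ) i) ℕ.∸ suc i) (N ℕ.∸ suc j)
        (Indices.row-index (ℕ.m∸n+n≡m (ℕ.≤-trans i<N (ℕ.m≤m+n N _))) (ℕ.m∸n+n≡m j<N))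
        (λ n → reflexive (≡.cong a (Indices.row-variable n (ℕ.m∸n+n≡m j<N))))
      columns-agree : ∀ i j → column-matrix i j ≋ ΛForms.sgn (colPos i ℕ.+ (N ℕ.+ j)) ⊗
        ΛF.F (embed ∘ b) signed-h (N ℕ.+ j) (colPos i)
      columns-agree i j = column-entry b (τ (+ 1 ℤ.- + suc j) (dual a)) (colPos i) (N ℕ.+ j)
        (Indices.column-index {N} {row (rows (μ ′)) i} {i} {j} {colPos i} (colPos+ i))
        (λ {m} {n} n<m eq → -‿cong (reflexive (≡.cong a
          (Indices.column-variable {N} {j} {colPos i} {m} n (≡.sym eq) (ℕ.m∸n+n≡m n<m)))))

theorem4 : ∀ {c r} (K : CommutativeRing c r) → let open SymmetricFunctions K in
    (ω : Λ → Λ) → IsOmega ω →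
    (a : Sequence) (μ : YoungDiagram) →
    ∀ N M → ℓ μ ≤ N → ℓ (μ ′) ≤ M →
    ω (s N μ a) ≋ s M (μ ′) (dual a)
theorem4 K ω isOmega = MultiparameterSchur.ω-s K isOmega
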